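{- Let $a$ and $b$ be positive integers with $b \geqslant 2$ and let $\ell = a + b - 1$. Let $\mathcal{F}_{a,b}$ denote the family of $a$-locally $b$-partite graphs. Then \[\delta_{\chi}(\mathcal{F}_{a,b}) = 1 - \frac{1}{\ell},\] and, in particular, the chromatic threshold of locally $b$-partite graphs, $\delta_{\chi}(\mathcal{F}_{1,b})$, is $1 - 1/b$.
   Context: All graphs are finite and simple; $|G|$ denotes the number of vertices of $G$ and $\delta(G)$ its minimum degree. For a set $X$ of vertices, $\Gamma(X)$ is the common neighbourhood of the vertices of $X$. A graph is $a$-locally $b$-partite if for every clique $K$ on $a$ vertices, the subgraph induced on the common neighbourhood $\Gamma(V(K))$ is $b$-colourable; locally $b$-partite means $1$-locally $b$-partite. For a family $\mathcal{F}$ of graphs and a positive integer $k$, $\delta_{\chi}(\mathcal{F},k) = \inf\{d : \text{every } G \in \mathcal{F} \text{ with } \delta(G) \geqslant d|G| \text{ satisfies } \chi(G) \leqslant k\}$, and the chromatic threshold is $\delta_{\chi}(\mathcal{F}) = \inf_k \delta_{\chi}(\mathcal{F},k)$, equivalently the infimum of those $d$ for which there is a constant $C = C(\mathcal{F},d)$ such that every $G\in\mathcal{F}$ with $\delta(G) \geqslant d|G|$ has $\chi(G)\leqslant C$. -}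

module Defs where

open import Data.Nat using (ℕ; zero; suc; _+_; _∸_)
open import Data.Bool using (Bool; true; false)
open import Data.Fin using (Fin)
import Data.Fin as F
open import Data.Integer using (+_)
open import Data.Rational using (ℚ; _/_; _*_; _-_; _≤_; _<_; 0ℚ; 1ℚ)
open import Data.Product using (Σ; _×_; ∃)
open import Relation.Binary.PropositionalEquality using (_≡_; _≢_)
open import Relation.Nullary using (¬_)
open import Level using (Level; suc; _⊔_) renaming (zero to lzero)

record Graph : Set where
  field
    n     : ℕ
    adj   : Fin n → Fin n → Bool
    sym   : ∀ u v → adj u v ≡ adj v u
    irrefl : ∀ v → adj v v ≡ false
open Graph public

order : Graph → ℕ
order G = n G

count : ∀ {m} → (Fin m → Bool) → ℕ
count {zero}  f = 0
count {ℕ.suc m} f with f F.zero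
... | true  = ℕ.suc (count (λ i → f (F.suc i)))
... | false = count (λ i → f (F.suc i))

degree : (G : Graph) → Fin (n G) → ℕ
degree G v = count (adj G v)

ℕtoℚ : ℕ → ℚ
ℕtoℚ m = + m / 1

MinDegreeAtLeast : Graph → ℚ → Set
MinDegreeAtLeast G d = ∀ v → d * ℕtoℚ (order G) ≤ ℕtoℚ (degree G v)

ColourableOn : (G : Graph) → (Fin (n G) → Set) → ℕ → Set
ColourableOn G S k =
  Σ (Fin (n G) → Fin k) λ c →
    ∀ u v → S u → S v → adj G u v ≡ true → c u ≢ c v

Colourable : Graph → ℕ → Set
Colourable G k =
  Σ (Fin (n G) → Fin k) λ c → ∀ u v → adj G u v ≡ true → c u ≢ c v

-- a clique on a vertices: a injective listing of a pairwise adjacent vertices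
IsClique : (G : Graph) → {a : ℕ} → (Fin a → Fin (n G)) → Set
IsClique G {a} K = ∀ i j → i ≢ j → adj G (K i) (K j) ≡ true

CommonNbhd : (G : Graph) → {a : ℕ} → (Fin a → Fin (n G)) → Fin (n G) → Set
CommonNbhd G K v = ∀ i → adj G (K i) v ≡ true

LocallyPartite : ℕ → ℕ → Graph → Set
LocallyPartite a b G =
  (K : Fin a → Fin (n G)) → IsClique G K → ColourableOn G (CommonNbhd G K) b

-- δ_χ(𝓕) = t, for a family 𝓕 given as a predicate on graphs.
-- The set of d admitting a bound C is upward closed, so inf = t is
-- equivalent to: every (rational) d > t admits C, and no d < t does.
ChromaticThresholdIs : (Graph → Set) → ℚ → Set
ChromaticThresholdIs 𝓕 t =
  (∀ d → t < d → ∃ λ C → ∀ G → 𝓕 G → MinDegreeAtLeast G d → Colourable G C)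
  × (∀ d → d < t → ∀ C → ∃ λ G → 𝓕 G × MinDegreeAtLeast G d × ¬ Colourable G C)

-- 1/m as a rational (only used for m ≥ 1; value at 0 irrelevant)
inv : ℕ → ℚ
inv zero = 0ℚ
inv (ℕ.suc m) = + 1 / ℕ.suc m

{-# OPTIONS --safe #-}
module Submission where

-- Put ℓ = a + b - 1.  A colour is lost with each clique vertex, so
-- 1-locally ℓ-partite ⇒ a-locally b-partite ⇒ (ℓ-1)-locally bipartite, and it
-- suffices to bound the last family above and the first one below.
--
-- Above 1 - 1/ℓ.  Any ℓ vertices have linearly many common neighbours.  For
-- j ∈ V^ℓ let N_j be the common neighbourhood.  A bounded sample of the N_j
-- controls the average of (|A ∩ N_j| - |B ∩ N_j|)² over all j, uniformly in
-- A, B ⊆ V.  Colour each vertex a by the approximate sizes of N(a) ∩ N_j for the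
-- sampled j.  If adjacent a, b had the same colour, then for some clique
-- h = (h₁, …, h_{ℓ-1}) in N(a) ∩ N(b) and some c ∈ N(h) both N(a) and N(b) would
-- meet N_{c,h}, say in t and s; then a b s c t is a 5-cycle in the common
-- neighbourhood of the clique h, which is bipartite.
--
-- Below 1 - 1/ℓ.  Join the increasing tuples of a long interval [N] by the shift
-- relation (x₁,…,x_r) ~ (x₂,…,x_{r+1}); the chromatic number is at least an
-- iterated logarithm of N.  Add a complete ℓ-partite graph whose parts consist of
-- (many copies of) all labellings f : [N] → [m], and join x to f in every part
-- but one when f(x₁) ≠ 0 and f vanishes somewhere on x₂,…,x_r, which holds for
-- almost all f.  The tuples seen by f are 2-coloured by the parity of the
-- position of the first zero of f, so neighbourhoods are ℓ-colourable.

module Development where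

  open import Defs hiding (sym)
  open import Data.Nat as ℕ using (ℕ; zero; suc; z≤n; s≤s)
  import Data.Nat.Properties as ℕₚ
  import Data.Nat.DivMod as ℕ÷
  open import Data.Nat.Tactic.RingSolver using () renaming (solve-∀ to ℕ-solve-∀)
  open import Data.Integer hiding (suc)
  open import Data.Integer.Properties
  open import Data.Integer.Tactic.RingSolver using (solve-∀)
  open import Data.Rational as ℚ using (ℚ; ↥_; ↧_; ↧ₙ_; toℚᵘ; 1ℚ)
  import Data.Rational.Properties as ℚₚ
  open import Data.Rational.Unnormalised as ℚᵘ using (mkℚᵘ; *≤*; *<*)
  import Data.Rational.Unnormalised.Properties as ℚᵘₚ
  open import Data.Bool using (Bool; true; false; not; _∧_; _∨_; if_then_else_)
  import Data.Bool.Properties as Boolₚ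
  open import Data.Empty using (⊥; ⊥-elim)
  open import Data.Fin as Fin using (Fin; zero; suc)
  import Data.Fin.Properties as Finₚ
  open import Data.List as List using (List; []; _∷_; _++_; map; length; tabulate; allFin; cartesianProductWith)
  open import Data.List.Properties using (length-tabulate; tabulate-lookup)
  open import Data.List.Membership.Propositional using (_∈_)
  open import Data.List.Membership.Propositional.Properties using (∈-allFin; ∈-map⁺; ∈-++⁺ˡ; ∈-cartesianProductWith⁺)
  open import Data.List.Relation.Unary.Any using (here; there; index)
  open import Data.List.Relation.Unary.Any.Properties using (lookup-index)
  open import Data.Vec as Vec using (Vec; []; _∷_; head; tail; init; lookup; _[_]≔_)
  import Data.Vec.Properties as Vecₚ
  open import Data.Product using (∃; _×_; _,_; proj₁; proj₂)
  open import Data.Sum using (_⊎_; inj₁; inj₂)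
  open import Data.Unit using (⊤; tt)
  open import Function using (id; _∘_)
  open import Relation.Nullary using (¬_; Dec; yes; no; does; _×-dec_; _⊎-dec_)
  open import Relation.Nullary.Decidable using (dec-true; dec-false)
  open import Relation.Binary.Definitions using (tri<; tri≈; tri>)
  open import Relation.Binary.PropositionalEquality

  -- Sums over lists and greedy sampling

  0≤pos : ∀ {n} → 0ℤ ≤ + n
  0≤pos = +≤+ z≤n

  0≤+ : ∀ {i j} → 0ℤ ≤ i → 0ℤ ≤ j → 0ℤ ≤ i + j
  0≤+ = +-mono-≤

  0≤* : ∀ {i j} → 0ℤ ≤ i → 0ℤ ≤ j → 0ℤ ≤ i * j
  0≤* {+ m} {+ n} _ _ = subst (0ℤ ≤_) (pos-* m n) 0≤pos

  0≤sq : ∀ i → 0ℤ ≤ i * i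
  0≤sq (+ n)    = 0≤* {+ n} 0≤pos 0≤pos
  0≤sq -[1+ n ] = 0≤pos

  *-mono-≤-nonNeg : ∀ {i j k l} → 0ℤ ≤ k → 0ℤ ≤ j → i ≤ j → k ≤ l → i * k ≤ j * l
  *-mono-≤-nonNeg {j = + j} {+ k} _ _ i≤j k≤l =
    ≤-trans (*-monoʳ-≤-nonNeg (+ k) i≤j) (*-monoˡ-≤-nonNeg (+ j) k≤l)

  *-monoˡ-0≤ : ∀ {k i j} → 0ℤ ≤ k → i ≤ j → k * i ≤ k * j
  *-monoˡ-0≤ {+ k} _ = *-monoˡ-≤-nonNeg (+ k)

  *-monoʳ-0≤ : ∀ {k i j} → 0ℤ ≤ k → i ≤ j → i * k ≤ j * k
  *-monoʳ-0≤ {+ k} _ = *-monoʳ-≤-nonNeg (+ k)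

  -- Inequalities below are certified by writing the larger side as the smaller
  -- one plus an evidently nonnegative slack, which leaves a ring identity.
  ≤-slack : ∀ {i j} k → 0ℤ ≤ k → j ≡ i + k → i ≤ j
  ≤-slack {i} k 0≤k refl = subst (_≤ i + k) (+-identityʳ i) (+-monoʳ-≤ i 0≤k)

  gap : ∀ {i j} → i ≤ j → 0ℤ ≤ j - i
  gap = i≤j⇒0≤j-i

  +-congˡ : ∀ k {i j} → i ≡ j → k + i ≡ k + j
  +-congˡ k refl = refl

  ⟦_⟧ : Bool → ℤ
  ⟦ true ⟧  = 1ℤ
  ⟦ false ⟧ = 0ℤ

  0≤⟦⟧ : ∀ b → 0ℤ ≤ ⟦ b ⟧
  0≤⟦⟧ true  = 0≤pos
  0≤⟦⟧ false = 0≤pos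

  ⟦⟧≤1 : ∀ b → ⟦ b ⟧ ≤ 1ℤ
  ⟦⟧≤1 true  = ≤-refl
  ⟦⟧≤1 false = 0≤pos

  size : ∀ {A : Set} → List A → ℤ
  size xs = + length xs

  ∑ : ∀ {A : Set} → List A → (A → ℤ) → ℤ
  ∑ []       f = 0ℤ
  ∑ (x ∷ xs) f = f x + ∑ xs f

  module _ {A : Set} where

    ∑-cong : ∀ (xs : List A) {f g} → (∀ x → f x ≡ g x) → ∑ xs f ≡ ∑ xs g
    ∑-cong []       e = refl
    ∑-cong (x ∷ xs) e = cong₂ _+_ (e x) (∑-cong xs e)

    ∑-mono : ∀ (xs : List A) {f g} → (∀ x → f x ≤ g x) → ∑ xs f ≤ ∑ xs g
    ∑-mono []       e = ≤-refl
    ∑-mono (x ∷ xs) e = +-mono-≤ (e x) (∑-mono xs e)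

    ∑-nonneg : ∀ (xs : List A) {f} → (∀ x → 0ℤ ≤ f x) → 0ℤ ≤ ∑ xs f
    ∑-nonneg []       e = ≤-refl
    ∑-nonneg (x ∷ xs) e = 0≤+ (e x) (∑-nonneg xs e)

    ∑-+ : ∀ (xs : List A) f g → ∑ xs (λ x → f x + g x) ≡ ∑ xs f + ∑ xs g
    ∑-+ []       f g = refl
    ∑-+ (x ∷ xs) f g rewrite ∑-+ xs f g =
      lem (f x) (g x) (∑ xs f) (∑ xs g)
      where
      lem : ∀ a b c d → (a + b) + (c + d) ≡ (a + c) + (b + d)
      lem = solve-∀

    ∑-* : ∀ (xs : List A) c f → ∑ xs (λ x → c * f x) ≡ c * ∑ xs f
    ∑-* []       c f = sym (*-zeroʳ c)
    ∑-* (x ∷ xs) c f rewrite ∑-* xs c f = sym (*-distribˡ-+ c (f x) (∑ xs f))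

    ∑-const : ∀ (xs : List A) c → ∑ xs (λ _ → c) ≡ size xs * c
    ∑-const []       c = sym (*-zeroˡ c)
    ∑-const (x ∷ xs) c rewrite ∑-const xs c = sym (suc-* (size xs) c)

    ∑-++ : ∀ (xs ys : List A) f → ∑ (xs ++ ys) f ≡ ∑ xs f + ∑ ys f
    ∑-++ []       ys f = sym (+-identityˡ _)
    ∑-++ (x ∷ xs) ys f rewrite ∑-++ xs ys f = sym (+-assoc (f x) _ _)

    ∑-map : ∀ {B : Set} (g : B → A) xs f → ∑ (map g xs) f ≡ ∑ xs (λ x → f (g x))
    ∑-map g []       f = refl
    ∑-map g (x ∷ xs) f = +-congˡ (f (g x)) (∑-map g xs f)

  ∑-zero : ∀ {A : Set} (xs : List A) → ∑ xs (λ _ → 0ℤ) ≡ 0ℤ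
  ∑-zero xs = trans (∑-const xs 0ℤ) (*-zeroʳ (size xs))

  ∑-swap : ∀ {A B : Set} (xs : List A) (ys : List B) (f : A → B → ℤ) →
           ∑ xs (λ x → ∑ ys (f x)) ≡ ∑ ys (λ y → ∑ xs (λ x → f x y))
  ∑-swap []       ys f = sym (∑-zero ys)
  ∑-swap (x ∷ xs) ys f rewrite ∑-swap xs ys f = sym (∑-+ ys (f x) _)

  ∑-product : ∀ {A B C : Set} (g : A → B → C) xs ys f →
              ∑ (cartesianProductWith g xs ys) f ≡ ∑ xs (λ x → ∑ ys (λ y → f (g x y)))
  ∑-product g []       ys f = refl
  ∑-product g (x ∷ xs) ys f =
    trans (∑-++ (map (g x) ys) _ f) (cong₂ _+_ (∑-map (g x) ys f) (∑-product g xs ys f))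

  -- Membership makes the list nonempty. Dropping a positive term keeps the sum nonpositive, so the
  -- search must meet a nonpositive term.
  ∑≤0⇒∃≤0 : ∀ {A : Set} {x : A} xs f → x ∈ xs → ∑ xs f ≤ 0ℤ → ∃ λ y → f y ≤ 0ℤ
  ∑≤0⇒∃≤0 {A} (x ∷ xs) f _ = search x xs
    where
    search : ∀ x xs → ∑ (x ∷ xs) f ≤ 0ℤ → ∃ λ y → f y ≤ 0ℤ
    search x []       s = x , subst (_≤ 0ℤ) (+-identityʳ (f x)) s
    search x (y ∷ xs) s with f x ≤? 0ℤ
    ... | yes p = x , p
    ... | no ¬p = search y xs (≤-trans
      (≤-slack (f x) (<⇒≤ (≰⇒> ¬p)) (+-comm (f x) (∑ (y ∷ xs) f))) s)

  ∑ᵥ : ∀ {A : Set} {m} → Vec A m → (A → ℤ) → ℤ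
  ∑ᵥ []       f = 0ℤ
  ∑ᵥ (x ∷ xs) f = f x + ∑ᵥ xs f

  -- Greedy form of Maurey's empirical method: the mean of vectors X j in the unit
  -- cube is approximated in Euclidean norm by the mean of few of them.  All
  -- quantities are scaled by the number of vectors, so everything is an integer.
  module Maurey {P J : Set} (ps : List P) (js : List J) {j₀ : J} (j₀∈js : j₀ ∈ js)
                (X : J → P → ℤ) (0≤X : ∀ j p → 0ℤ ≤ X j p) (X≤1 : ∀ j p → X j p ≤ 1ℤ) where

    D : ℤ
    D = size js

    total : P → ℤ
    total p = ∑ js (λ j → X j p)

    dev : J → P → ℤ
    dev i p = total p - D * X i p

    residual : ∀ {m} → Vec J m → P → ℤ
    residual []       p = 0ℤ
    residual (i ∷ is) p = dev i p + residual is p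

    norm² : (P → ℤ) → ℤ
    norm² M = ∑ ps (λ p → M p * M p)

    total≤D : ∀ p → total p ≤ D
    total≤D p = subst (total p ≤_) (trans (∑-const js 1ℤ) (*-identityʳ D)) (∑-mono js (λ j → X≤1 j p))

    dev²≤D² : ∀ i p → dev i p * dev i p ≤ D * D
    dev²≤D² i p = ≤-slack ((D - (Y - D * x)) * (D + (Y - D * x)))
      (0≤* (subst (0ℤ ≤_) (eq₁ D Y x) (0≤+ (gap (total≤D p)) (0≤* {D} 0≤pos (0≤X i p))))
           (subst (0ℤ ≤_) (eq₂ D Y x)
             (0≤+ (∑-nonneg js (λ j → 0≤X j p)) (0≤* {D} 0≤pos (gap (X≤1 i p))))))
      (eq₃ D (Y - D * x))
      where
      Y x : ℤ
      Y = total p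
      x = X i p
      eq₁ : ∀ D Y x → (D - Y) + D * x ≡ D - (Y - D * x)
      eq₁ = solve-∀
      eq₂ : ∀ D Y x → Y + D * (1ℤ - x) ≡ D + (Y - D * x)
      eq₂ = solve-∀
      eq₃ : ∀ D u → D * D ≡ u * u + (D - u) * (D + u)
      eq₃ = solve-∀

    ∑dev≡0 : ∀ p → ∑ js (λ i → dev i p) ≡ 0ℤ
    ∑dev≡0 p = begin
      ∑ js (λ i → total p - D * X i p)              ≡⟨ ∑-cong js (λ i → eq₁ (total p) D (X i p)) ⟩
      ∑ js (λ i → total p + - D * X i p)            ≡⟨ ∑-+ js (λ _ → total p) (λ i → - D * X i p) ⟩
      ∑ js (λ _ → total p) + ∑ js (λ i → - D * X i p)
        ≡⟨ cong₂ _+_ (∑-const js (total p)) (∑-* js (- D) (λ i → X i p)) ⟩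
      D * total p + - D * total p                   ≡⟨ eq₂ D (total p) ⟩
      0ℤ ∎
      where
      open ≡-Reasoning
      eq₁ : ∀ Y D x → Y - D * x ≡ Y + - D * x
      eq₁ = solve-∀
      eq₂ : ∀ D Y → D * Y + - D * Y ≡ 0ℤ
      eq₂ = solve-∀

    -- At each `p` the deviations sum to zero over `js`, so their correlations with a fixed `R` sum
    -- to zero as well and cannot all be positive.
    ∃-nonpositive-correlation : ∀ (R : P → ℤ) → ∃ λ i → ∑ ps (λ p → dev i p * R p) ≤ 0ℤ
    ∃-nonpositive-correlation R = ∑≤0⇒∃≤0 js _ j₀∈js (≤-reflexive (begin
      ∑ js (λ i → ∑ ps (λ p → dev i p * R p))  ≡⟨ ∑-swap js ps (λ i p → dev i p * R p) ⟩
      ∑ ps (λ p → ∑ js (λ i → dev i p * R p))  ≡⟨ ∑-cong ps (λ p → ∑-cong js (λ i → *-comm (dev i p) (R p))) ⟩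
      ∑ ps (λ p → ∑ js (λ i → R p * dev i p))  ≡⟨ ∑-cong ps (λ p → ∑-* js (R p) (λ i → dev i p)) ⟩
      ∑ ps (λ p → R p * ∑ js (λ i → dev i p))  ≡⟨ ∑-cong ps (λ p → trans (cong (R p *_) (∑dev≡0 p)) (*-zeroʳ (R p))) ⟩
      ∑ ps (λ p → 0ℤ)                          ≡⟨ ∑-zero ps ⟩
      0ℤ ∎))
      where open ≡-Reasoning

    norm²-+ : ∀ M R → norm² (λ p → M p + R p) ≡ norm² M + (+ 2 * ∑ ps (λ p → M p * R p) + norm² R)
    norm²-+ M R = begin
      norm² (λ p → M p + R p)
        ≡⟨ ∑-cong ps (λ p → eq (M p) (R p)) ⟩
      ∑ ps (λ p → M p * M p + (+ 2 * (M p * R p) + R p * R p))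
        ≡⟨ ∑-+ ps _ _ ⟩
      norm² M + ∑ ps (λ p → + 2 * (M p * R p) + R p * R p)
        ≡⟨ +-congˡ (norm² M) (∑-+ ps _ _) ⟩
      norm² M + (∑ ps (λ p → + 2 * (M p * R p)) + norm² R)
        ≡⟨ cong (λ z → norm² M + (z + norm² R)) (∑-* ps (+ 2) _) ⟩
      norm² M + (+ 2 * ∑ ps (λ p → M p * R p) + norm² R) ∎
      where
      open ≡-Reasoning
      eq : ∀ a b → (a + b) * (a + b) ≡ a * a + (+ 2 * (a * b) + b * b)
      eq = solve-∀

    -- The next index is chosen to correlate nonpositively with the current residual. The cross term
    -- in the squared norm can then be dropped, and each index adds only its own squared deviation.
    sample : ∀ m → ∃ λ (is : Vec J m) → norm² (residual is) ≤ + m * (size ps * (D * D))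
    sample zero = [] , ≤-reflexive (∑-zero ps)
    sample (suc m) with sample m
    ... | is , bound with ∃-nonpositive-correlation (residual is)
    ... | i , corr = i ∷ is , (begin
      norm² (λ p → dev i p + residual is p)  ≡⟨ norm²-+ (dev i) (residual is) ⟩
      norm² (dev i) + (+ 2 * ∑ ps (λ p → dev i p * residual is p) + norm² (residual is))
        ≤⟨ +-mono-≤ dev-bound (+-mono-≤ (*-monoˡ-≤-nonNeg (+ 2) corr) bound) ⟩
      K + (+ 2 * 0ℤ + + m * K)               ≡⟨ eq K (+ m) ⟩
      (1ℤ + + m) * K ∎)
      where
      open ≤-Reasoning
      K : ℤ
      K = size ps * (D * D)
      dev-bound : norm² (dev i) ≤ K
      dev-bound = subst (norm² (dev i) ≤_) (∑-const ps (D * D)) (∑-mono ps (dev²≤D² i))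
      eq : ∀ K m → K + (+ 2 * 0ℤ + m * K) ≡ (1ℤ + m) * K
      eq = solve-∀

    ⟨_,_⟩ : (P → ℤ) → (P → ℤ) → ℤ
    ⟨ g , M ⟩ = ∑ ps (λ p → g p * M p)

    ⟨⟩-total : ∀ g → ⟨ g , total ⟩ ≡ ∑ js (λ j → ⟨ g , X j ⟩)
    ⟨⟩-total g = trans (∑-cong ps (λ p → sym (∑-* js (g p) (λ j → X j p))))
                       (∑-swap ps js (λ p j → g p * X j p))

    ⟨⟩-dev : ∀ g i → ⟨ g , dev i ⟩ ≡ ⟨ g , total ⟩ + - D * ⟨ g , X i ⟩
    ⟨⟩-dev g i = begin
      ∑ ps (λ p → g p * (total p - D * X i p))           ≡⟨ ∑-cong ps (λ p → eq (g p) (total p) D (X i p)) ⟩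
      ∑ ps (λ p → g p * total p + - D * (g p * X i p))   ≡⟨ ∑-+ ps _ _ ⟩
      ⟨ g , total ⟩ + ∑ ps (λ p → - D * (g p * X i p))   ≡⟨ +-congˡ ⟨ g , total ⟩ (∑-* ps (- D) _) ⟩
      ⟨ g , total ⟩ + - D * ⟨ g , X i ⟩ ∎
      where
      open ≡-Reasoning
      eq : ∀ g Y D x → g * (Y - D * x) ≡ g * Y + - D * (g * x)
      eq = solve-∀

    ⟨⟩-residual : ∀ g {m} (is : Vec J m) →
                  ⟨ g , residual is ⟩ ≡ + m * ∑ js (λ j → ⟨ g , X j ⟩) - D * ∑ᵥ is (λ i → ⟨ g , X i ⟩)
    ⟨⟩-residual g [] = begin
      ∑ ps (λ p → g p * 0ℤ)  ≡⟨ ∑-cong ps (λ p → *-zeroʳ (g p)) ⟩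
      ∑ ps (λ p → 0ℤ)        ≡⟨ ∑-zero ps ⟩
      0ℤ                     ≡⟨ eq (∑ js (λ j → ⟨ g , X j ⟩)) D ⟩
      + 0 * ∑ js (λ j → ⟨ g , X j ⟩) - D * 0ℤ ∎
      where
      open ≡-Reasoning
      eq : ∀ t D → 0ℤ ≡ 0ℤ * t - D * 0ℤ
      eq = solve-∀
    ⟨⟩-residual g {suc m} (i ∷ is) = begin
      ∑ ps (λ p → g p * (dev i p + residual is p))
        ≡⟨ ∑-cong ps (λ p → *-distribˡ-+ (g p) (dev i p) (residual is p)) ⟩
      ∑ ps (λ p → g p * dev i p + g p * residual is p)
        ≡⟨ ∑-+ ps _ _ ⟩
      ⟨ g , dev i ⟩ + ⟨ g , residual is ⟩
        ≡⟨ cong₂ _+_ (trans (⟨⟩-dev g i) (cong (_+ - D * ⟨ g , X i ⟩) (⟨⟩-total g))) (⟨⟩-residual g is) ⟩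
      (E + - D * x) + (+ m * E - D * F)
        ≡⟨ eq E D x (+ m) F ⟩
      (1ℤ + + m) * E - D * (x + F) ∎
      where
      open ≡-Reasoning
      E x F : ℤ
      E = ∑ js (λ j → ⟨ g , X j ⟩)
      x = ⟨ g , X i ⟩
      F = ∑ᵥ is (λ i → ⟨ g , X i ⟩)
      eq : ∀ E D x m F → (E + - D * x) + (m * E - D * F) ≡ (1ℤ + m) * E - D * (x + F)
      eq = solve-∀

    -- Cauchy-Schwarz against the residual without square roots, the scale `t` being left to the
    -- caller. The sample is fixed before `g`, so one sample serves all test functions with values
    -- between -1 and 1; hence the number of colours will not depend on the graph.
    sample-approximates : ∀ m → ∃ λ (is : Vec J m) →
      ∀ t g → (∀ p → g p * g p ≤ 1ℤ) →
      + 2 * (t * (+ m * ∑ js (λ j → ⟨ g , X j ⟩) - D * ∑ᵥ is (λ i → ⟨ g , X i ⟩)))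
        ≤ size ps * (t * t) + + m * (size ps * (D * D))
    sample-approximates m with sample m
    ... | is , bound = is , λ t g g²≤1 → begin
      + 2 * (t * (+ m * ∑ js (λ j → ⟨ g , X j ⟩) - D * ∑ᵥ is (λ i → ⟨ g , X i ⟩)))
        ≡⟨ cong (λ z → + 2 * (t * z)) (sym (⟨⟩-residual g is)) ⟩
      + 2 * (t * ⟨ g , residual is ⟩)
        ≡⟨ sym (*-assoc (+ 2) t _) ⟩
      + 2 * t * ⟨ g , residual is ⟩
        ≡⟨ sym (∑-* ps (+ 2 * t) _) ⟩
      ∑ ps (λ p → + 2 * t * (g p * residual is p))
        ≤⟨ ∑-mono ps (λ p → am-gm t (g p) (residual is p) (g²≤1 p)) ⟩
      ∑ ps (λ p → t * t + residual is p * residual is p)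
        ≡⟨ ∑-+ ps _ _ ⟩
      ∑ ps (λ p → t * t) + norm² (residual is)
        ≡⟨ cong (_+ _) (∑-const ps (t * t)) ⟩
      size ps * (t * t) + norm² (residual is)
        ≤⟨ +-monoʳ-≤ (size ps * (t * t)) bound ⟩
      size ps * (t * t) + + m * (size ps * (D * D)) ∎
      where
      open ≤-Reasoning
      am-gm : ∀ t g r → g * g ≤ 1ℤ → + 2 * t * (g * r) ≤ t * t + r * r
      am-gm t g r h = ≤-slack ((t - g * r) * (t - g * r) + (1ℤ - g * g) * (r * r))
        (0≤+ (0≤sq (t - g * r)) (0≤* (gap h) (0≤sq r))) (eq t g r)
        where
        eq : ∀ t g r → t * t + r * r ≡ + 2 * t * (g * r) + ((t - g * r) * (t - g * r) + (1ℤ - g * g) * (r * r))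
        eq = solve-∀

  -- Colouring above the threshold

  ∧-splitˡ : ∀ {x y} → x ∧ y ≡ true → x ≡ true
  ∧-splitˡ {true} _ = refl

  ∧-splitʳ : ∀ {x y} → x ∧ y ≡ true → y ≡ true
  ∧-splitʳ {true} e = e

  ⟦∧⟧ : ∀ x y → ⟦ x ∧ y ⟧ ≡ ⟦ x ⟧ * ⟦ y ⟧
  ⟦∧⟧ true  y = sym (*-identityˡ ⟦ y ⟧)
  ⟦∧⟧ false y = refl

  tuples : ∀ {A : Set} → List A → ∀ m → List (Vec A m)
  tuples xs zero    = [] ∷ []
  tuples xs (suc m) = cartesianProductWith _∷_ xs (tuples xs m)

  ∈-tuples : ∀ {A : Set} {xs : List A} → (∀ x → x ∈ xs) → ∀ {m} (v : Vec A m) → v ∈ tuples xs m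
  ∈-tuples all []      = here refl
  ∈-tuples all (x ∷ v) = ∈-cartesianProductWith⁺ _∷_ (all x) (∈-tuples all v)

  size≡∑1 : ∀ {A : Set} (xs : List A) → size xs ≡ ∑ xs (λ _ → 1ℤ)
  size≡∑1 xs = sym (trans (∑-const xs 1ℤ) (*-identityʳ (size xs)))

  size-product : ∀ {A B C : Set} (g : A → B → C) xs ys →
                 size (cartesianProductWith g xs ys) ≡ size xs * size ys
  size-product g xs ys = begin
    size (cartesianProductWith g xs ys)        ≡⟨ size≡∑1 (cartesianProductWith g xs ys) ⟩
    ∑ (cartesianProductWith g xs ys) (λ _ → 1ℤ) ≡⟨ ∑-product g xs ys _ ⟩
    ∑ xs (λ _ → ∑ ys (λ _ → 1ℤ))               ≡⟨ ∑-const xs _ ⟩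
    size xs * ∑ ys (λ _ → 1ℤ)                  ≡⟨ cong (size xs *_) (sym (size≡∑1 ys)) ⟩
    size xs * size ys ∎
    where open ≡-Reasoning

  size-pos : ∀ {A : Set} {x : A} {xs} → x ∈ xs → 1ℤ ≤ size xs
  size-pos (here _)  = +≤+ (s≤s z≤n)
  size-pos (there _) = +≤+ (s≤s z≤n)

  ∑⟦⟧≡0⊎∃ : ∀ {A : Set} (xs : List A) (p : A → Bool) →
           ∑ xs (λ x → ⟦ p x ⟧) ≡ 0ℤ ⊎ ∃ λ x → p x ≡ true
  ∑⟦⟧≡0⊎∃ []       p = inj₁ refl
  ∑⟦⟧≡0⊎∃ (x ∷ xs) p with p x in eq
  ... | true  = inj₂ (x , eq)
  ... | false with ∑⟦⟧≡0⊎∃ xs p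
  ... | inj₁ e = inj₁ (trans (+-identityˡ _) e)
  ... | inj₂ r = inj₂ r

  ∑⟦⟧≤size : ∀ {A : Set} (xs : List A) (p : A → Bool) → ∑ xs (λ x → ⟦ p x ⟧) ≤ size xs
  ∑⟦⟧≤size xs p = subst (∑ xs (λ x → ⟦ p x ⟧) ≤_) (sym (size≡∑1 xs)) (∑-mono xs (λ x → ⟦⟧≤1 (p x)))

  ∑-square : ∀ {A : Set} (xs : List A) (u : A → ℤ) →
              ∑ (cartesianProductWith _,_ xs xs) (λ p → u (proj₁ p) * u (proj₂ p)) ≡ ∑ xs u * ∑ xs u
  ∑-square xs u = begin
    ∑ (cartesianProductWith _,_ xs xs) (λ p → u (proj₁ p) * u (proj₂ p)) ≡⟨ ∑-product _,_ xs xs _ ⟩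
    ∑ xs (λ x → ∑ xs (λ y → u x * u y))  ≡⟨ ∑-cong xs (λ x → trans (∑-* xs (u x) u) (*-comm (u x) _)) ⟩
    ∑ xs (λ x → ∑ xs u * u x)            ≡⟨ ∑-* xs (∑ xs u) u ⟩
    ∑ xs u * ∑ xs u ∎
    where open ≡-Reasoning

  ∑ᵥ-bound : ∀ {A : Set} {m} (is : Vec A m) (F : A → ℤ) c b →
             (∀ i → c * F (Vec.lookup is i) ≤ b) → c * ∑ᵥ is F ≤ + m * b
  ∑ᵥ-bound []       F c b h = ≤-reflexive (trans (*-zeroʳ c) (sym (*-zeroˡ b)))
  ∑ᵥ-bound {m = suc m} (x ∷ is) F c b h = begin
    c * (F x + ∑ᵥ is F)      ≡⟨ *-distribˡ-+ c (F x) _ ⟩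
    c * F x + c * ∑ᵥ is F    ≤⟨ +-mono-≤ (h zero) (∑ᵥ-bound is F c b (λ i → h (suc i))) ⟩
    b + + m * b              ≡⟨ sym (suc-* (+ m) b) ⟩
    (1ℤ + + m) * b ∎
    where open ≤-Reasoning

  diff²≤ : ∀ {u w n} → 0ℤ ≤ u → u ≤ n → 0ℤ ≤ w → w ≤ n → (u - w) * (u - w) ≤ n * n
  diff²≤ {u} {w} {n} 0≤u u≤n 0≤w w≤n =
    ≤-slack (((n - u) + w) * ((n - w) + u))
      (0≤* (0≤+ (gap u≤n) 0≤w) (0≤+ (gap w≤n) 0≤u)) (eq u w n)
    where
    eq : ∀ u w n → n * n ≡ (u - w) * (u - w) + ((n - u) + w) * ((n - w) + u)
    eq = solve-∀

  -- The difference equals that of the remainders, both between 0 and `n`. Colours will be rounded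
  -- counts, and this recovers closeness of the counts from equality of the colours.
  same-quotient : ∀ x y n .{{_ : ℕ.NonZero n}} → x ℕ./ n ≡ y ℕ./ n →
                  (+ x - + y) * (+ x - + y) ≤ + n * + n
  same-quotient x y n e = subst (λ z → z * z ≤ + n * + n) (sym eq)
    (diff²≤ 0≤pos (+≤+ (ℕₚ.<⇒≤ (ℕ÷.m%n<n x n))) 0≤pos (+≤+ (ℕₚ.<⇒≤ (ℕ÷.m%n<n y n))))
    where
    split : ∀ x → + x ≡ + (x ℕ.% n) + + (x ℕ./ n) * + n
    split x = trans (cong +_ (ℕ÷.m≡m%n+[m/n]*n x n))
      (trans (pos-+ (x ℕ.% n) _) (+-congˡ (+ (x ℕ.% n)) (pos-* (x ℕ./ n) n)))
    cancel : ∀ a b c → (a + c) - (b + c) ≡ a - b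
    cancel = solve-∀
    eq : + x - + y ≡ + (x ℕ.% n) - + (y ℕ.% n)
    eq = trans (cong₂ _-_ (split x) (trans (split y) (cong (λ z → + (y ℕ.% n) + + z * + n) (sym e))))
               (cancel (+ (x ℕ.% n)) (+ (y ℕ.% n)) (+ (x ℕ./ n) * + n))

  -- With two colours, vertices two steps apart on a path agree. Going from `a` to `s` to `t` gives
  -- the neighbours `a` and `t` the same colour.
  no-C₅-in-Fin2 : ∀ (a b s c t : Fin 2) → a ≢ b → b ≢ s → s ≢ c → c ≢ t → t ≢ a → ⊥
  no-C₅-in-Fin2 a b s c t ab bs sc ct ta =
    ta (sym (trans (two-apart a b s ab bs) (two-apart s c t sc ct)))
    where
    two-apart : ∀ (x y z : Fin 2) → x ≢ y → y ≢ z → x ≡ z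
    two-apart zero       zero       _          p q = ⊥-elim (p refl)
    two-apart zero       (suc zero) zero       p q = refl
    two-apart zero       (suc zero) (suc zero) p q = ⊥-elim (q refl)
    two-apart (suc zero) zero       zero       p q = ⊥-elim (q refl)
    two-apart (suc zero) zero       (suc zero) p q = refl
    two-apart (suc zero) (suc zero) _          p q = ⊥-elim (p refl)

  ∑ᵥ-cong : ∀ {A : Set} {m} (is : Vec A m) {f g} → (∀ i → f i ≡ g i) → ∑ᵥ is f ≡ ∑ᵥ is g
  ∑ᵥ-cong []       e = refl
  ∑ᵥ-cong (i ∷ is) e = cong₂ _+_ (e i) (∑ᵥ-cong is e)

  1≤* : ∀ {i j} → 1ℤ ≤ i → 1ℤ ≤ j → 1ℤ ≤ i * j
  1≤* {i} 1≤i 1≤j = *-mono-≤-nonNeg {j = i} 0≤pos (≤-trans 0≤pos 1≤i) 1≤i 1≤j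

  -- With Q = p², sample length m = (2Q)² and test parameter t = 2QD, the three
  -- bounds add up to 8 Q³ N² D² ≤ 0.
  contradictory-bounds : ∀ p N D E E′ → 1ℤ ≤ p → 1ℤ ≤ N → 1ℤ ≤ D →
    let Q = p * p
        τ = + 2 * Q
        t = D * τ
    in N * N * D ≤ Q * E →
       (+ 2 * p) * (+ 2 * p) * E′ ≤ τ * τ * (N * N) →
       + 2 * (t * (τ * τ * E - D * E′)) ≤ N * N * (t * t) + τ * τ * (N * N * (D * D)) → ⊥
  contradictory-bounds p N D E E′ 1≤p 1≤N 1≤D h₁ h₂ h₃ = 1≰0 (≤-trans 1≤Z (≤-slack _ nonneg (eq p N D E E′)))
    where
    1≰0 : ¬ 1ℤ ≤ 0ℤ
    1≰0 (+≤+ ())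
    Q τ : ℤ
    Q = p * p
    τ = + 2 * Q
    1≤Q : 1ℤ ≤ Q
    1≤Q = 1≤* 1≤p 1≤p
    1≤Z : 1ℤ ≤ + 8 * (Q * Q * Q * (N * N) * (D * D))
    1≤Z = 1≤* {+ 8} (+≤+ (s≤s z≤n)) (1≤* (1≤* (1≤* (1≤* 1≤Q 1≤Q) 1≤Q) (1≤* 1≤N 1≤N)) (1≤* 1≤D 1≤D))
    0≤Q : 0ℤ ≤ Q
    0≤Q = 0≤sq p
    0≤D : 0ℤ ≤ D
    0≤D = ≤-trans 0≤pos 1≤D
    0≤τ : 0ℤ ≤ τ
    0≤τ = 0≤* {+ 2} 0≤pos 0≤Q
    nonneg : 0ℤ ≤ + 2 * Q * (N * N * ((D * τ) * (D * τ)) + τ * τ * (N * N * (D * D)) - + 2 * ((D * τ) * (τ * τ * E - D * E′)))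
                + (+ 4 * (D * (τ * (τ * τ))) * (Q * E - N * N * D)
                + D * D * τ * (τ * τ * (N * N) - (+ 2 * p) * (+ 2 * p) * E′))
    nonneg = 0≤+ (0≤* (0≤* {+ 2} 0≤pos 0≤Q) (gap h₃))
      (0≤+ (0≤* (0≤* {+ 4} 0≤pos (0≤* 0≤D (0≤* 0≤τ (0≤sq τ)))) (gap h₁))
           (0≤* (0≤* (0≤sq D) 0≤τ) (gap h₂)))
    eq : ∀ p N D E E′ →
      let Q = p * p
          τ = + 2 * Q
      in 0ℤ ≡ + 8 * (Q * Q * Q * (N * N) * (D * D))
           + (+ 2 * Q * (N * N * ((D * τ) * (D * τ)) + τ * τ * (N * N * (D * D)) - + 2 * ((D * τ) * (τ * τ * E - D * E′)))
              + (+ 4 * (D * (τ * (τ * τ))) * (Q * E - N * N * D)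
              + D * D * τ * (τ * τ * (N * N) - (+ 2 * p) * (+ 2 * p) * E′)))
    eq = solve-∀

  -- Common neighbourhoods, cliques and discrepancy

  module _ (G : Graph) where

    V : Set
    V = Fin (n G)

    vs : List V
    vs = allFin (n G)

    common : ∀ {m} → Vec V m → V → Bool
    common []       x = true
    common (y ∷ ys) x = adj G y x ∧ common ys x

    common-count : ∀ {m} → Vec V m → ℤ
    common-count ys = ∑ vs (λ x → ⟦ common ys x ⟧)

    common-lookup : ∀ {m} (ys : Vec V m) {x} → common ys x ≡ true → ∀ i → adj G (Vec.lookup ys i) x ≡ true
    common-lookup (y ∷ ys) e zero    = ∧-splitˡ e
    common-lookup (y ∷ ys) e (suc i) = common-lookup ys (∧-splitʳ {adj G y _} e) i

  -- Here `k = ℓ - 1`. The minimum degree enters only through `common-large`: at most ℓ vertices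
  -- always share a fraction `1/q` of all vertices as neighbours.
  module UpperBound (G : Graph) (k q : ℕ) (locally-bipartite : LocallyPartite k 2 G)
    (common-large : ∀ {m} (ys : Vec (V G) m) → m ℕ.≤ suc k → size (vs G) ≤ + q * common-count G ys) where

    private
      N : ℤ
      N = size (vs G)

    adj-sym : ∀ {x y} → adj G x y ≡ true → adj G y x ≡ true
    adj-sym {x} {y} e = trans (sym (Graph.sym G x y)) e

    module _ (a b : V G) where

      cliqueIn : ∀ {m} → Vec (V G) m → Bool
      cliqueIn []       = true
      cliqueIn (x ∷ hs) = cliqueIn hs ∧ common G (a ∷ b ∷ hs) x

      cliqueIn-sees : ∀ {m} (hs : Vec (V G) m) → cliqueIn hs ≡ true → ∀ i →
                      adj G (Vec.lookup hs i) a ≡ true × adj G (Vec.lookup hs i) b ≡ true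
      cliqueIn-sees (x ∷ hs) e zero    =
        adj-sym (∧-splitˡ (∧-splitʳ {cliqueIn hs} e)) ,
        adj-sym (∧-splitˡ (∧-splitʳ {adj G a x} (∧-splitʳ {cliqueIn hs} e)))
      cliqueIn-sees (x ∷ hs) e (suc i) = cliqueIn-sees hs (∧-splitˡ e) i

      cliqueIn-clique : ∀ {m} (hs : Vec (V G) m) → cliqueIn hs ≡ true → IsClique G (Vec.lookup hs)
      cliqueIn-clique (x ∷ hs) e zero    zero    i≢j = ⊥-elim (i≢j refl)
      cliqueIn-clique (x ∷ hs) e zero    (suc j) i≢j = adj-sym (cliqueIn-clique (x ∷ hs) e (suc j) zero (λ ()))
      cliqueIn-clique (x ∷ hs) e (suc i) zero    i≢j =
        common-lookup G hs (∧-splitʳ {adj G b x} (∧-splitʳ {adj G a x} (∧-splitʳ {cliqueIn hs} e))) i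
      cliqueIn-clique (x ∷ hs) e (suc i) (suc j) i≢j =
        cliqueIn-clique hs (∧-splitˡ e) i j (λ i≡j → i≢j (cong suc i≡j))

      -- The clique is extended one vertex at a time. Before each extension it has, together with
      -- `a` and `b`, at most `suc k` vertices, so at least `N/q` choices remain.
      cliques-many : ∀ m → suc m ℕ.≤ suc k →
        size (tuples (vs G) m) ≤ + (q ℕ.^ m) * ∑ (tuples (vs G) m) (λ hs → ⟦ cliqueIn hs ⟧)
      cliques-many zero    _  = ≤-refl
      cliques-many (suc m) le = begin
        size (tuples (vs G) (suc m))
          ≡⟨ size-product _∷_ (vs G) (tuples (vs G) m) ⟩
        N * size (tuples (vs G) m)
          ≤⟨ *-monoˡ-0≤ {N} 0≤pos (cliques-many m (ℕₚ.<⇒≤ le)) ⟩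
        N * (+ (q ℕ.^ m) * ∑ ts (λ hs → ⟦ cliqueIn hs ⟧))
          ≡⟨ eq₁ N (+ (q ℕ.^ m)) _ ⟩
        + (q ℕ.^ m) * (N * ∑ ts (λ hs → ⟦ cliqueIn hs ⟧))
          ≡⟨ cong (+ (q ℕ.^ m) *_) (sym (∑-* ts N _)) ⟩
        + (q ℕ.^ m) * ∑ ts (λ hs → N * ⟦ cliqueIn hs ⟧)
          ≤⟨ *-monoˡ-0≤ {+ (q ℕ.^ m)} 0≤pos (∑-mono ts (λ hs →
               *-monoʳ-0≤ (0≤⟦⟧ (cliqueIn hs)) (common-large (a ∷ b ∷ hs) le))) ⟩
        + (q ℕ.^ m) * ∑ ts (λ hs → + q * common-count G (a ∷ b ∷ hs) * ⟦ cliqueIn hs ⟧)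
          ≡⟨ cong (+ (q ℕ.^ m) *_) (trans (∑-cong ts (λ hs → *-assoc (+ q) _ _)) (∑-* ts (+ q) _)) ⟩
        + (q ℕ.^ m) * (+ q * ∑ ts (λ hs → common-count G (a ∷ b ∷ hs) * ⟦ cliqueIn hs ⟧))
          ≡⟨ eq₂ (+ (q ℕ.^ m)) (+ q) _ ⟩
        + q * + (q ℕ.^ m) * ∑ ts (λ hs → common-count G (a ∷ b ∷ hs) * ⟦ cliqueIn hs ⟧)
          ≡⟨ cong₂ _*_ (sym (pos-* q (q ℕ.^ m))) (sym regroup) ⟩
        + (q ℕ.^ suc m) * ∑ (tuples (vs G) (suc m)) (λ hs → ⟦ cliqueIn hs ⟧) ∎
        where
        open ≤-Reasoning
        ts : List (Vec (V G) m)
        ts = tuples (vs G) m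
        eq₁ : ∀ n p s → n * (p * s) ≡ p * (n * s)
        eq₁ = solve-∀
        eq₂ : ∀ n p s → n * (p * s) ≡ p * n * s
        eq₂ = solve-∀
        regroup : ∑ (tuples (vs G) (suc m)) (λ hs → ⟦ cliqueIn hs ⟧)
                  ≡ ∑ ts (λ hs → common-count G (a ∷ b ∷ hs) * ⟦ cliqueIn hs ⟧)
        regroup = trans (∑-product _∷_ (vs G) ts _) (trans (∑-swap (vs G) ts _) (∑-cong ts (λ hs →
          trans (∑-cong (vs G) (λ x → ⟦∧⟧ (cliqueIn hs) _))
                (trans (∑-* (vs G) ⟦ cliqueIn hs ⟧ _) (*-comm ⟦ cliqueIn hs ⟧ _)))))

      -- Selects the tuples whose common neighbourhood cannot be met by both `N(a)` and `N(b)` when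
      -- `a` and `b` are adjacent.
      weight : Vec (V G) (suc k) → Bool
      weight (c ∷ hs) = cliqueIn hs ∧ common G hs c

      -- Pairs `(s, c)` are counted with `s` first: `s` is a common neighbour of `b ∷ hs`, then `c`
      -- one of `s ∷ hs`. Starting with `c` would require common neighbours of `b ∷ c ∷ hs`, one
      -- vertex more than `common-large` allows.
      seen-from : ∀ hs → N * N ≤ + q * (+ q * ∑ (vs G) (λ c → ⟦ common G hs c ⟧ * common-count G (b ∷ c ∷ hs)))
      seen-from hs = begin
        N * N
          ≤⟨ *-monoˡ-0≤ {N} 0≤pos (common-large (b ∷ hs) ℕₚ.≤-refl) ⟩
        N * (+ q * common-count G (b ∷ hs))
          ≡⟨ eq N (+ q) _ ⟩
        + q * (N * common-count G (b ∷ hs))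
          ≡⟨ cong (+ q *_) (sym (∑-* (vs G) N _)) ⟩
        + q * ∑ (vs G) (λ s → N * ⟦ common G (b ∷ hs) s ⟧)
          ≤⟨ *-monoˡ-0≤ {+ q} 0≤pos (∑-mono (vs G) (λ s →
               *-monoʳ-0≤ (0≤⟦⟧ (common G (b ∷ hs) s)) (common-large (s ∷ hs) ℕₚ.≤-refl))) ⟩
        + q * ∑ (vs G) (λ s → + q * common-count G (s ∷ hs) * ⟦ common G (b ∷ hs) s ⟧)
          ≡⟨ cong (+ q *_) (trans (∑-cong (vs G) (λ s → *-assoc (+ q) _ _)) (∑-* (vs G) (+ q) _)) ⟩
        + q * (+ q * ∑ (vs G) (λ s → common-count G (s ∷ hs) * ⟦ common G (b ∷ hs) s ⟧))
          ≡⟨ cong (λ z → + q * (+ q * z)) regroup ⟩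
        + q * (+ q * ∑ (vs G) (λ c → ⟦ common G hs c ⟧ * common-count G (b ∷ c ∷ hs))) ∎
        where
        open ≤-Reasoning
        eq : ∀ n p s → n * (p * s) ≡ p * (n * s)
        eq = solve-∀
        swap-adj : ∀ s c →
          ⟦ common G (b ∷ hs) s ⟧ * ⟦ common G (s ∷ hs) c ⟧ ≡ ⟦ common G hs c ⟧ * ⟦ common G (b ∷ c ∷ hs) s ⟧
        swap-adj s c rewrite Graph.sym G s c with adj G b s | adj G c s | common G hs c | common G hs s
        ... | false | false | false | _     = refl
        ... | false | false | true  | _     = refl
        ... | false | true  | false | _     = refl
        ... | false | true  | true  | _     = refl
        ... | true  | false | false | false = refl
        ... | true  | false | false | true  = refl
        ... | true  | false | true  | false = refl
        ... | true  | false | true  | true  = refl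
        ... | true  | true  | false | false = refl
        ... | true  | true  | false | true  = refl
        ... | true  | true  | true  | false = refl
        ... | true  | true  | true  | true  = refl
        regroup : ∑ (vs G) (λ s → common-count G (s ∷ hs) * ⟦ common G (b ∷ hs) s ⟧)
                  ≡ ∑ (vs G) (λ c → ⟦ common G hs c ⟧ * common-count G (b ∷ c ∷ hs))
        regroup = begin-equality
          ∑ (vs G) (λ s → common-count G (s ∷ hs) * ⟦ common G (b ∷ hs) s ⟧)
            ≡⟨ ∑-cong (vs G) (λ s → trans (*-comm (common-count G (s ∷ hs)) _) (sym (∑-* (vs G) ⟦ common G (b ∷ hs) s ⟧ _))) ⟩
          ∑ (vs G) (λ s → ∑ (vs G) (λ c → ⟦ common G (b ∷ hs) s ⟧ * ⟦ common G (s ∷ hs) c ⟧))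
            ≡⟨ ∑-cong (vs G) (λ s → ∑-cong (vs G) (swap-adj s)) ⟩
          ∑ (vs G) (λ s → ∑ (vs G) (λ c → ⟦ common G hs c ⟧ * ⟦ common G (b ∷ c ∷ hs) s ⟧))
            ≡⟨ ∑-swap (vs G) (vs G) _ ⟩
          ∑ (vs G) (λ c → ∑ (vs G) (λ s → ⟦ common G hs c ⟧ * ⟦ common G (b ∷ c ∷ hs) s ⟧))
            ≡⟨ ∑-cong (vs G) (λ c → ∑-* (vs G) ⟦ common G hs c ⟧ _) ⟩
          ∑ (vs G) (λ c → ⟦ common G hs c ⟧ * common-count G (b ∷ c ∷ hs)) ∎

      -- Combines the cliques `hs`, a fraction `1/q^k` of all `k`-tuples, with the pairs `(s, c)`
      -- over each of them, a fraction `1/q^2`.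
      weighted-many : N * size (tuples (vs G) (suc k)) ≤
        + (q ℕ.^ suc (suc k)) * ∑ (tuples (vs G) (suc k)) (λ j → ⟦ weight j ⟧ * common-count G (b ∷ j))
      weighted-many = begin
        N * size (tuples (vs G) (suc k))
          ≡⟨ cong (N *_) (size-product _∷_ (vs G) ts) ⟩
        N * (N * size ts)
          ≤⟨ *-monoˡ-0≤ {N} 0≤pos (*-monoˡ-0≤ {N} 0≤pos (cliques-many k ℕₚ.≤-refl)) ⟩
        N * (N * (Q * ∑ ts (λ hs → ⟦ cliqueIn hs ⟧)))
          ≡⟨ eq₁ N Q _ ⟩
        Q * (N * N * ∑ ts (λ hs → ⟦ cliqueIn hs ⟧))
          ≡⟨ cong (Q *_) (sym (∑-* ts (N * N) _)) ⟩
        Q * ∑ ts (λ hs → N * N * ⟦ cliqueIn hs ⟧)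
          ≤⟨ *-monoˡ-0≤ {Q} 0≤pos (∑-mono ts (λ hs → *-monoʳ-0≤ (0≤⟦⟧ (cliqueIn hs)) (seen-from hs))) ⟩
        Q * ∑ ts (λ hs → + q * (+ q * seen hs) * ⟦ cliqueIn hs ⟧)
          ≡⟨ cong (Q *_) (trans (∑-cong ts (λ hs → eq₂ (+ q) (seen hs) ⟦ cliqueIn hs ⟧)) (∑-* ts (+ q * + q) _)) ⟩
        Q * (+ q * + q * ∑ ts (λ hs → ⟦ cliqueIn hs ⟧ * seen hs))
          ≡⟨ eq₃ Q (+ q) _ ⟩
        + q * (+ q * Q) * ∑ ts (λ hs → ⟦ cliqueIn hs ⟧ * seen hs)
          ≡⟨ cong₂ _*_ (sym (trans (pos-* q (q ℕ.^ suc k)) (cong (+ q *_) (pos-* q (q ℕ.^ k))))) (sym regroup) ⟩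
        + (q ℕ.^ suc (suc k)) * ∑ (tuples (vs G) (suc k)) (λ j → ⟦ weight j ⟧ * common-count G (b ∷ j)) ∎
        where
        open ≤-Reasoning
        ts : List (Vec (V G) k)
        ts = tuples (vs G) k
        Q : ℤ
        Q = + (q ℕ.^ k)
        seen : Vec (V G) k → ℤ
        seen hs = ∑ (vs G) (λ c → ⟦ common G hs c ⟧ * common-count G (b ∷ c ∷ hs))
        eq₁ : ∀ n p s → n * (n * (p * s)) ≡ p * (n * n * s)
        eq₁ = solve-∀
        eq₂ : ∀ q s c → q * (q * s) * c ≡ q * q * (c * s)
        eq₂ = solve-∀
        eq₃ : ∀ p q s → p * (q * q * s) ≡ q * (q * p) * s
        eq₃ = solve-∀
        regroup : ∑ (tuples (vs G) (suc k)) (λ j → ⟦ weight j ⟧ * common-count G (b ∷ j))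
                  ≡ ∑ ts (λ hs → ⟦ cliqueIn hs ⟧ * seen hs)
        regroup = trans (∑-product _∷_ (vs G) ts _) (trans (∑-swap (vs G) ts _) (∑-cong ts (λ hs →
          trans (∑-cong (vs G) (λ c → trans (cong (_* common-count G (b ∷ c ∷ hs)) (⟦∧⟧ (cliqueIn hs) _))
                                            (*-assoc ⟦ cliqueIn hs ⟧ _ _)))
                (∑-* (vs G) ⟦ cliqueIn hs ⟧ _))))

      discrepancy : Vec (V G) (suc k) → ℤ
      discrepancy j = common-count G (a ∷ j) - common-count G (b ∷ j)

      -- If both a and b see a vertex of the common neighbourhood of c ∷ hs, these
      -- two vertices close a 5-cycle through a, b and c in the neighbourhood of hs.
      weighted-discrepancy : adj G a b ≡ true → ∀ j →
        ⟦ weight j ⟧ * common-count G (b ∷ j) * (⟦ weight j ⟧ * common-count G (b ∷ j)) ≤ discrepancy j * discrepancy j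
      weighted-discrepancy ab (c ∷ hs) with weight (c ∷ hs) in w
      ... | false = 0≤sq (discrepancy (c ∷ hs))
      ... | true with ∑⟦⟧≡0⊎∃ (vs G) (common G (b ∷ c ∷ hs)) | ∑⟦⟧≡0⊎∃ (vs G) (common G (a ∷ c ∷ hs))
      ... | inj₁ e | _ rewrite e = 0≤sq (common-count G (a ∷ c ∷ hs) - 0ℤ)
      ... | inj₂ _ | inj₁ e rewrite e = ≤-reflexive (eq (common-count G (b ∷ c ∷ hs)))
        where
        eq : ∀ x → 1ℤ * x * (1ℤ * x) ≡ (0ℤ - x) * (0ℤ - x)
        eq = solve-∀
      ... | inj₂ (s , es) | inj₂ (t , et) = ⊥-elim
        (no-C₅-in-Fin2 (col a) (col b) (col s) (col c) (col t)
          (proper a b a∈ b∈ ab)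
          (proper b s b∈ s∈ (∧-splitˡ es))
          (proper s c s∈ c∈ (adj-sym (∧-splitˡ (∧-splitʳ {adj G b s} es))))
          (proper c t c∈ t∈ (∧-splitˡ (∧-splitʳ {adj G a t} et)))
          (proper t a t∈ a∈ (adj-sym (∧-splitˡ et))))
        where
        clique : cliqueIn hs ≡ true
        clique = ∧-splitˡ w
        two-colouring : ColourableOn G (CommonNbhd G (Vec.lookup hs)) 2
        two-colouring = locally-bipartite (Vec.lookup hs) (cliqueIn-clique hs clique)
        col : V G → Fin 2
        col = proj₁ two-colouring
        proper : ∀ u v → CommonNbhd G (Vec.lookup hs) u → CommonNbhd G (Vec.lookup hs) v → adj G u v ≡ true → col u ≢ col v
        proper = proj₂ two-colouring
        a∈ : CommonNbhd G (Vec.lookup hs) a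
        a∈ i = proj₁ (cliqueIn-sees hs clique i)
        b∈ : CommonNbhd G (Vec.lookup hs) b
        b∈ i = proj₂ (cliqueIn-sees hs clique i)
        c∈ : CommonNbhd G (Vec.lookup hs) c
        c∈ = common-lookup G hs (∧-splitʳ {cliqueIn hs} w)
        s∈ : CommonNbhd G (Vec.lookup hs) s
        s∈ = common-lookup G hs (∧-splitʳ {adj G c s} (∧-splitʳ {adj G b s} es))
        t∈ : CommonNbhd G (Vec.lookup hs) t
        t∈ = common-lookup G hs (∧-splitʳ {adj G c t} (∧-splitʳ {adj G a t} et))

      -- Cauchy-Schwarz in pointwise form: the square of `N - P * wt j` is nonnegative, which turns
      -- the bound on the sum of `wt` into one on the sum of its squares, and `weighted-discrepancy`
      -- passes to the discrepancy.
      discrepancy-large : adj G a b ≡ true →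
        N * N * size (tuples (vs G) (suc k)) ≤
        + (q ℕ.^ suc (suc k)) * + (q ℕ.^ suc (suc k)) * ∑ (tuples (vs G) (suc k)) (λ j → discrepancy j * discrepancy j)
      discrepancy-large ab = ≤-trans (≤-slack
          ((S₂ - (+ 2 * N * P * S₁ - N * N * D)) + + 2 * N * (P * S₁ - N * D))
          (0≤+ (gap cauchy) (0≤* {+ 2 * N} (0≤* {+ 2} {N} 0≤pos 0≤pos) (gap weighted-many)))
          (eq S₂ N P S₁ D))
        (≤-reflexive (∑-* js (P * P) _))
        where
        js : List (Vec (V G) (suc k))
        js = tuples (vs G) (suc k)
        wt : Vec (V G) (suc k) → ℤ
        wt j = ⟦ weight j ⟧ * common-count G (b ∷ j)
        P D S₁ S₂ : ℤ
        P  = + (q ℕ.^ suc (suc k))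
        D  = size js
        S₁ = ∑ js wt
        S₂ = ∑ js (λ j → P * P * (discrepancy j * discrepancy j))
        eq : ∀ S N P T D → S ≡ N * N * D + ((S - (+ 2 * N * P * T - N * N * D)) + + 2 * N * (P * T - N * D))
        eq = solve-∀
        pointwise : ∀ j → + 2 * N * P * wt j + - (N * N) ≤ P * P * (discrepancy j * discrepancy j)
        pointwise j = ≤-slack ((N - P * wt j) * (N - P * wt j) + P * P * (discrepancy j * discrepancy j - wt j * wt j))
          (0≤+ (0≤sq (N - P * wt j)) (0≤* (0≤sq P) (gap (weighted-discrepancy ab j))))
          (eq′ N P (wt j) (discrepancy j * discrepancy j))
          where
          eq′ : ∀ N P w d → P * P * d ≡ (+ 2 * N * P * w + - (N * N)) + ((N - P * w) * (N - P * w) + P * P * (d - w * w))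
          eq′ = solve-∀
        cauchy : + 2 * N * P * S₁ - N * N * D ≤ S₂
        cauchy = begin
          + 2 * N * P * S₁ - N * N * D               ≡⟨ eq″ N P S₁ D ⟩
          + 2 * N * P * S₁ + D * - (N * N)           ≡⟨ sym (cong₂ _+_ (∑-* js (+ 2 * N * P) wt) (∑-const js (- (N * N)))) ⟩
          ∑ js (λ j → + 2 * N * P * wt j) + ∑ js (λ _ → - (N * N)) ≡⟨ sym (∑-+ js _ _) ⟩
          ∑ js (λ j → + 2 * N * P * wt j + - (N * N)) ≤⟨ ∑-mono js pointwise ⟩
          S₂ ∎
          where
          open ≤-Reasoning
          eq″ : ∀ N P S D → + 2 * N * P * S - N * N * D ≡ + 2 * N * P * S + D * - (N * N)
          eq″ = solve-∀

    -- On an edge the mean squared discrepancy is at least `N²/P²`. If the ends have equal colours,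
    -- rounding to multiples of `N/g` leaves at most a quarter of this on the sample, while the
    -- sampling error `N²/τ` is only half of it.
    P Q τ m g : ℕ
    P = q ℕ.^ suc (suc k)
    Q = P ℕ.* P
    τ = 2 ℕ.* Q
    m = τ ℕ.* τ
    g = 2 ℕ.* P

    colours : ℕ
    colours = suc g ℕ.^ m

    module _ (v₀ : V G) (0<q : 0 ℕ.< q) where

      private
        js : List (Vec (V G) (suc k))
        js = tuples (vs G) (suc k)

        j₀∈js : Vec.replicate (suc k) v₀ ∈ js
        j₀∈js = ∈-tuples ∈-allFin (Vec.replicate (suc k) v₀)

        indicator : Vec (V G) (suc k) → V G → ℤ
        indicator j s = ⟦ common G j s ⟧

        instance
          vs-nonZero : ℕ.NonZero (length (vs G))
          vs-nonZero = ℕ.>-nonZero (drop‿+≤+ (size-pos (∈-allFin v₀)))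

        -- A squared discrepancy is quadratic in the indicator of `N_j`, hence linear in its tensor
        -- square. So it is the tensor squares, on pairs of vertices, that are sampled.
        open Maurey (cartesianProductWith _,_ (vs G) (vs G)) js j₀∈js
          (λ j p → indicator j (proj₁ p) * indicator j (proj₂ p))
          (λ j p → 0≤* (0≤⟦⟧ (common G j (proj₁ p))) (0≤⟦⟧ (common G j (proj₂ p))))
          (λ j p → *-mono-≤-nonNeg {j = 1ℤ} (0≤⟦⟧ (common G j (proj₂ p))) 0≤pos
                     (⟦⟧≤1 (common G j (proj₁ p))) (⟦⟧≤1 (common G j (proj₂ p))))

        is : Vec (Vec (V G) (suc k)) m
        is = proj₁ (sample-approximates m)

        trace : V G → Vec (V G) (suc k) → ℕ
        trace a j = ∣ common-count G (a ∷ j) ∣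

        trace-count : ∀ a j → + trace a j ≡ common-count G (a ∷ j)
        trace-count a j = 0≤i⇒+∣i∣≡i (∑-nonneg (vs G) (λ s → 0≤⟦⟧ (common G (a ∷ j) s)))

        trace≤ : ∀ a j → trace a j ℕ.≤ length (vs G)
        trace≤ a j = drop‿+≤+ (subst (_≤ N) (sym (trace-count a j)) (∑⟦⟧≤size (vs G) (common G (a ∷ j))))

        quotient< : ∀ a j → g ℕ.* trace a j ℕ./ length (vs G) ℕ.< suc g
        quotient< a j = s≤s (subst (g ℕ.* trace a j ℕ./ length (vs G) ℕ.≤_) (ℕ÷.m*n/n≡m g (length (vs G)))
          (ℕ÷./-monoˡ-≤ (length (vs G)) (ℕₚ.*-monoʳ-≤ g (trace≤ a j))))

        profile : V G → Fin m → Fin (suc g)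
        profile a i = Fin.fromℕ< (quotient< a (Vec.lookup is i))

      colour : V G → Fin colours
      colour a = Fin.funToFin (profile a)

      private
        diff : V G → V G → V G × V G → ℤ
        diff a b p = (⟦ adj G a (proj₁ p) ⟧ - ⟦ adj G b (proj₁ p) ⟧) * (⟦ adj G a (proj₂ p) ⟧ - ⟦ adj G b (proj₂ p) ⟧)

        diff²≤1 : ∀ a b p → diff a b p * diff a b p ≤ 1ℤ
        diff²≤1 a b (s , t) with adj G a s | adj G b s | adj G a t | adj G b t
        ... | true  | true  | _     | _     = 0≤pos
        ... | false | false | _     | _     = 0≤pos
        ... | true  | false | true  | true  = 0≤pos
        ... | true  | false | false | false = 0≤pos
        ... | true  | false | true  | false = ≤-refl
        ... | true  | false | false | true  = ≤-refl
        ... | false | true  | true  | true  = 0≤pos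
        ... | false | true  | false | false = 0≤pos
        ... | false | true  | true  | false = ≤-refl
        ... | false | true  | false | true  = ≤-refl

        -- `diff a b` is the tensor square of the difference of the indicators of `N(a)` and `N(b)`.
        -- Pairing two tensor squares gives the square of the pairing of the factors.
        ⟨diff⟩ : ∀ a b j → ⟨ diff a b , (λ p → indicator j (proj₁ p) * indicator j (proj₂ p)) ⟩
                           ≡ discrepancy a b j * discrepancy a b j
        ⟨diff⟩ a b j = begin
          ⟨ diff a b , (λ p → indicator j (proj₁ p) * indicator j (proj₂ p)) ⟩
            ≡⟨ ∑-cong (cartesianProductWith _,_ (vs G) (vs G)) (λ p →
                 interchange (f (proj₁ p)) (f (proj₂ p)) (indicator j (proj₁ p)) (indicator j (proj₂ p))) ⟩
          ∑ (cartesianProductWith _,_ (vs G) (vs G))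
            (λ p → f (proj₁ p) * indicator j (proj₁ p) * (f (proj₂ p) * indicator j (proj₂ p)))
            ≡⟨ ∑-square (vs G) (λ s → f s * indicator j s) ⟩
          ∑ (vs G) (λ s → f s * indicator j s) * ∑ (vs G) (λ s → f s * indicator j s)
            ≡⟨ cong (λ z → z * z) linear ⟩
          discrepancy a b j * discrepancy a b j ∎
          where
          open ≡-Reasoning
          f : V G → ℤ
          f s = ⟦ adj G a s ⟧ - ⟦ adj G b s ⟧
          interchange : ∀ x y z w → x * y * (z * w) ≡ x * z * (y * w)
          interchange = solve-∀
          expand : ∀ x y z → (x - y) * z ≡ x * z + - 1ℤ * (y * z)
          expand = solve-∀
          collect : ∀ x y → x + - 1ℤ * y ≡ x - y
          collect = solve-∀
          linear : ∑ (vs G) (λ s → f s * indicator j s) ≡ discrepancy a b j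
          linear = begin
            ∑ (vs G) (λ s → f s * indicator j s)
              ≡⟨ ∑-cong (vs G) (λ s → trans (expand ⟦ adj G a s ⟧ ⟦ adj G b s ⟧ (indicator j s))
                   (sym (cong₂ (λ x y → x + - 1ℤ * y) (⟦∧⟧ (adj G a s) (common G j s)) (⟦∧⟧ (adj G b s) (common G j s))))) ⟩
            ∑ (vs G) (λ s → ⟦ common G (a ∷ j) s ⟧ + - 1ℤ * ⟦ common G (b ∷ j) s ⟧)
              ≡⟨ ∑-+ (vs G) _ _ ⟩
            common-count G (a ∷ j) + ∑ (vs G) (λ s → - 1ℤ * ⟦ common G (b ∷ j) s ⟧)
              ≡⟨ +-congˡ (common-count G (a ∷ j)) (∑-* (vs G) (- 1ℤ) _) ⟩
            common-count G (a ∷ j) + - 1ℤ * common-count G (b ∷ j)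
              ≡⟨ collect (common-count G (a ∷ j)) (common-count G (b ∷ j)) ⟩
            discrepancy a b j ∎

        -- Equal colours give equal quotients of `g * trace` by the number of vertices at every
        -- sampled tuple, so the scaled counts differ by at most `N`.
        sample-discrepancy-small : ∀ a b → colour a ≡ colour b → ∀ i →
          + g * + g * (discrepancy a b (Vec.lookup is i) * discrepancy a b (Vec.lookup is i)) ≤ N * N
        sample-discrepancy-small a b e i = subst (_≤ N * N)
          (trans (cong (λ z → z * z) (cong₂ _-_ (scaled a) (scaled b))) (eq (+ g) _ _))
          (same-quotient (g ℕ.* trace a j) (g ℕ.* trace b j) (length (vs G)) quotients)
          where
          j : Vec (V G) (suc k)
          j = Vec.lookup is i
          scaled : ∀ a → + (g ℕ.* trace a j) ≡ + g * common-count G (a ∷ j)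
          scaled a = trans (pos-* g (trace a j)) (cong (+ g *_) (trace-count a j))
          eq : ∀ g x y → (g * x - g * y) * (g * x - g * y) ≡ g * g * ((x - y) * (x - y))
          eq = solve-∀
          profiles : profile a i ≡ profile b i
          profiles = trans (sym (Finₚ.finToFun-funToFin (profile a) i))
            (trans (cong (λ c → Fin.finToFun c i) e) (Finₚ.finToFun-funToFin (profile b) i))
          quotients : g ℕ.* trace a j ℕ./ length (vs G) ≡ g ℕ.* trace b j ℕ./ length (vs G)
          quotients = trans (sym (Finₚ.toℕ-fromℕ< (quotient< a j)))
            (trans (cong Fin.toℕ profiles) (Finₚ.toℕ-fromℕ< (quotient< b j)))

      colour-proper : ∀ a b → adj G a b ≡ true → colour a ≢ colour b
      colour-proper a b ab e = contradictory-bounds (+ P) N (size js) E E′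
        (+≤+ (ℕₚ.m^n>0 q {{ℕ.>-nonZero 0<q}} (suc (suc k)))) (size-pos (∈-allFin v₀)) (size-pos j₀∈js)
        (discrepancy-large a b ab) spread approx
        where
        E E′ : ℤ
        E  = ∑ js (λ j → discrepancy a b j * discrepancy a b j)
        E′ = ∑ᵥ is (λ j → discrepancy a b j * discrepancy a b j)
        g≡ : + g ≡ + 2 * + P
        g≡ = pos-* 2 P
        τ≡ : + τ ≡ + 2 * (+ P * + P)
        τ≡ = trans (pos-* 2 Q) (cong (+ 2 *_) (pos-* P P))
        m≡ : + m ≡ (+ 2 * (+ P * + P)) * (+ 2 * (+ P * + P))
        m≡ = trans (pos-* τ τ) (cong₂ _*_ τ≡ τ≡)
        spread : (+ 2 * + P) * (+ 2 * + P) * E′ ≤ (+ 2 * (+ P * + P)) * (+ 2 * (+ P * + P)) * (N * N)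
        spread = subst₂ (λ x y → x * x * E′ ≤ y * (N * N)) g≡ m≡
          (∑ᵥ-bound is _ (+ g * + g) (N * N) (sample-discrepancy-small a b e))
        t : ℤ
        -- Since `m = τ * τ`, this scale makes the two terms on the right of `sample-approximates`
        -- equal.
        t = size js * (+ 2 * (+ P * + P))
        approx : + 2 * (t * ((+ 2 * (+ P * + P)) * (+ 2 * (+ P * + P)) * E - size js * E′))
                 ≤ N * N * (t * t) + (+ 2 * (+ P * + P)) * (+ 2 * (+ P * + P)) * (N * N * (size js * size js))
        approx = subst₂ (λ y z → + 2 * (t * (y * E - size js * E′)) ≤ z * (t * t) + y * (z * (size js * size js)))
          m≡ (size-product _,_ (vs G) (vs G))
          (subst₂ (λ x y → + 2 * (t * (+ m * x - size js * y))
                           ≤ size pairs * (t * t) + + m * (size pairs * (size js * size js)))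
            (∑-cong js (⟨diff⟩ a b)) (∑ᵥ-cong is (⟨diff⟩ a b))
            (proj₂ (sample-approximates m) t (diff a b) (diff²≤1 a b)))
          where
          pairs : List (V G × V G)
          pairs = cartesianProductWith _,_ (vs G) (vs G)

  -- Rational minimum degrees and large common neighbourhoods

  private
    scale : ∀ d m → toℚᵘ (d ℚ.* ℕtoℚ m) ℚᵘ.≃ toℚᵘ d ℚᵘ.* mkℚᵘ (+ m) 0
    scale d m = ℚᵘₚ.≃-trans (ℚₚ.toℚᵘ-homo-* d (ℕtoℚ m)) (ℚᵘₚ.*-congˡ {toℚᵘ d} (ℚₚ.toℚᵘ-fromℚᵘ (mkℚᵘ (+ m) 0)))

    one-minus : ∀ k → toℚᵘ (1ℚ ℚ.- inv (suc k)) ℚᵘ.≃ ℚᵘ.1ℚᵘ ℚᵘ.- mkℚᵘ 1ℤ k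
    one-minus k = ℚᵘₚ.≃-trans (ℚₚ.toℚᵘ-homo-+ 1ℚ (ℚ.- inv (suc k))) (ℚᵘₚ.+-congʳ ℚᵘ.1ℚᵘ
      (ℚᵘₚ.≃-trans (ℚₚ.toℚᵘ-homo‿- (inv (suc k))) (ℚᵘₚ.-‿cong (ℚₚ.toℚᵘ-fromℚᵘ (mkℚᵘ 1ℤ k)))))

    x≡x*1 : ∀ x → x ≡ x * 1ℤ
    x≡x*1 = solve-∀

    xy≡y*x1 : ∀ x y → x * y ≡ y * (x * 1ℤ)
    xy≡y*x1 = solve-∀

    one-minus-num : ∀ k q → (1ℤ * (1ℤ + k) + - 1ℤ * 1ℤ) * q ≡ k * q
    one-minus-num = solve-∀

  ≤-scaled : ∀ d m e → ↥ d * + m ≤ ↧ d * + e → d ℚ.* ℕtoℚ m ℚ.≤ ℕtoℚ e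
  ≤-scaled d@record{} m e h = ℚₚ.toℚᵘ-cancel-≤ (ℚᵘₚ.≤-respˡ-≃ (ℚᵘₚ.≃-sym (scale d m)) (ℚᵘₚ.≤-respʳ-≃
    (ℚᵘₚ.≃-sym (ℚₚ.toℚᵘ-fromℚᵘ (mkℚᵘ (+ e) 0))) (*≤* (subst₂ _≤_ (x≡x*1 _) (xy≡y*x1 (↧ d) (+ e)) h))))

  scaled-≤ : ∀ d m e → d ℚ.* ℕtoℚ m ℚ.≤ ℕtoℚ e → ↥ d * + m ≤ ↧ d * + e
  scaled-≤ d@record{} m e h
    with ℚᵘₚ.≤-respˡ-≃ (scale d m) (ℚᵘₚ.≤-respʳ-≃ (ℚₚ.toℚᵘ-fromℚᵘ (mkℚᵘ (+ e) 0)) (ℚₚ.toℚᵘ-mono-≤ h))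
  ... | *≤* p = subst₂ _≤_ (sym (x≡x*1 (↥ d * + m))) (sym (xy≡y*x1 (↧ d) (+ e))) p

  threshold-< : ∀ k d → 1ℚ ℚ.- inv (suc k) ℚ.< d → + k * ↧ d < ↥ d * + suc k
  threshold-< k d@record{} h with ℚᵘₚ.<-respˡ-≃ (one-minus k) (ℚₚ.toℚᵘ-mono-< h)
  ... | *<* p = subst₂ _<_ (one-minus-num (+ k) (↧ d)) (cong (λ z → ↥ d * z) (*-identityˡ (+ suc k))) p

  <-threshold : ∀ k d → d ℚ.< 1ℚ ℚ.- inv (suc k) → ↥ d * + suc k < + k * ↧ d
  <-threshold k d@record{} h with ℚᵘₚ.<-respʳ-≃ (one-minus k) (ℚₚ.toℚᵘ-mono-< h)
  ... | *<* p = subst₂ _<_ (cong (λ z → ↥ d * z) (*-identityˡ (+ suc k))) (one-minus-num (+ k) (↧ d)) p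

  ∑-tabulate : ∀ {A : Set} {m} (h : Fin m → A) (p : A → Bool) →
               ∑ (tabulate h) (λ x → ⟦ p x ⟧) ≡ + count (p ∘ h)
  ∑-tabulate {m = zero}  h p = refl
  ∑-tabulate {m = suc m} h p with p (h zero)
  ... | true  = +-congˡ 1ℤ (∑-tabulate (h ∘ suc) p)
  ... | false = trans (+-identityˡ _) (∑-tabulate (h ∘ suc) p)

  -- With minimum degree at least `p N / q`, every further vertex destroys at most `(1 - p/q) N`
  -- common neighbours. The counts before and after are `c` and `c′`, and `m` vertices came earlier.
  deficit-step : ∀ p q N c c′ e m → 0ℤ ≤ q → q * N ≤ q * c + m * ((q - p) * N) → c + e ≤ c′ + N → p * N ≤ q * e →
                 q * N ≤ q * c′ + (1ℤ + m) * ((q - p) * N)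
  deficit-step p q N c c′ e m 0≤q h₁ h₂ h₃ = ≤-slack
    ((q * c + m * ((q - p) * N) - q * N) + (q * (c′ + N - (c + e)) + (q * e - p * N)))
    (0≤+ (gap h₁) (0≤+ (0≤* 0≤q (gap h₂)) (gap h₃))) (eq p q N c c′ e m)
    where
    eq : ∀ p q N c c′ e m → q * c′ + (1ℤ + m) * ((q - p) * N) ≡ q * N
       + ((q * c + m * ((q - p) * N) - q * N) + (q * (c′ + N - (c + e)) + (q * e - p * N)))
    eq = solve-∀

  -- For integers, `k/(k+1) < p/q` leaves a gap of 1, so `(k+1)(q-p) ≤ q-1`. Thus at most
  -- `(1 - 1/q) N` vertices are lost.
  deficit-bound : ∀ p q N c m k → 0ℤ ≤ N → q * N ≤ q * c + m * ((q - p) * N) → m ≤ 1ℤ + k →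
                  0ℤ ≤ (q - p) * N → 1ℤ + k * q ≤ p * (1ℤ + k) → N ≤ q * c
  deficit-bound p q N c m k 0≤N h₁ h₂ h₃ h₄ = ≤-slack
    ((q * c + m * ((q - p) * N) - q * N) + ((1ℤ + k - m) * ((q - p) * N) + (p * (1ℤ + k) - (1ℤ + k * q)) * N))
    (0≤+ (gap h₁) (0≤+ (0≤* (gap h₂) h₃) (0≤* (gap h₄) 0≤N))) (eq p q N c m k)
    where
    eq : ∀ p q N c m k → q * c ≡ N + ((q * c + m * ((q - p) * N) - q * N)
       + ((1ℤ + k - m) * ((q - p) * N) + (p * (1ℤ + k) - (1ℤ + k * q)) * N))
    eq = solve-∀

  module _ (G : Graph) (k : ℕ) (d : ℚ) (k/[1+k]<d : + k * ↧ d < ↥ d * + suc k)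
           (min-degree : MinDegreeAtLeast G d) where

    private
      N : ℤ
      N = size (vs G)

      deg : V G → ℤ
      deg v = ∑ (vs G) (λ x → ⟦ adj G v x ⟧)

      deg-large : ∀ v → ↥ d * N ≤ ↧ d * deg v
      deg-large v = subst₂ (λ x y → ↥ d * x ≤ ↧ d * y)
        (cong +_ (sym (length-tabulate {n = n G} id))) (sym (∑-tabulate id (adj G v)))
        (scaled-≤ d (n G) (degree G v) (min-degree v))

      0≤deficit : V G → 0ℤ ≤ (↧ d - ↥ d) * N
      0≤deficit v = subst (0ℤ ≤_) (eq (↥ d) (↧ d) N (deg v))
        (0≤+ (gap (deg-large v)) (0≤* {↧ d} 0≤pos (gap (∑⟦⟧≤size (vs G) (adj G v)))))
        where
        eq : ∀ p q N e → (q * e - p * N) + q * (N - e) ≡ (q - p) * N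
        eq = solve-∀

      common-∷ : ∀ {m} y (ys : Vec (V G) m) → common-count G ys + deg y ≤ common-count G (y ∷ ys) + N
      common-∷ y ys = subst₂ _≤_ (∑-+ (vs G) _ _)
        (trans (∑-+ (vs G) _ _) (+-congˡ (common-count G (y ∷ ys)) (sym (size≡∑1 (vs G)))))
        (∑-mono (vs G) (λ x → pointwise (adj G y x) (common G ys x)))
        where
        pointwise : ∀ b c → ⟦ c ⟧ + ⟦ b ⟧ ≤ ⟦ b ∧ c ⟧ + 1ℤ
        pointwise true  true  = ≤-refl
        pointwise true  false = ≤-refl
        pointwise false true  = ≤-refl
        pointwise false false = 0≤pos

      common-deficit : ∀ {m} (ys : Vec (V G) m) → ↧ d * N ≤ ↧ d * common-count G ys + + m * ((↧ d - ↥ d) * N)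
      common-deficit [] = ≤-reflexive (trans (cong (↧ d *_) (size≡∑1 (vs G))) (eq (↧ d * common-count G []) ((↧ d - ↥ d) * N)))
        where
        eq : ∀ x y → x ≡ x + 0ℤ * y
        eq = solve-∀
      common-deficit {suc m} (y ∷ ys) = subst (λ z → ↧ d * N ≤ ↧ d * common-count G (y ∷ ys) + z * ((↧ d - ↥ d) * N))
        (sym (pos-+ 1 m))
        (deficit-step (↥ d) (↧ d) N (common-count G ys) (common-count G (y ∷ ys)) (deg y) (+ m)
          0≤pos (common-deficit ys) (common-∷ y ys) (deg-large y))

    common-nbhd-large : ∀ {m} (ys : Vec (V G) m) → m ℕ.≤ suc k → N ≤ + ↧ₙ d * common-count G ys
    -- Without a listed vertex there is no degree to show that `(q - p) N` is nonnegative; here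
    -- nothing is lost and `q ≥ 1` suffices.
    common-nbhd-large [] _ = subst (λ x → N ≤ + ↧ₙ d * x) (size≡∑1 (vs G))
      (subst (_≤ + ↧ₙ d * N) (*-identityˡ N) (*-monoʳ-0≤ {N} 0≤pos (+≤+ (ℕ.>-nonZero⁻¹ (↧ₙ d)))))
    common-nbhd-large {m} ys@(y ∷ _) m≤1+k = deficit-bound (↥ d) (↧ d) N (common-count G ys) (+ m) (+ k)
      0≤pos (common-deficit ys) (+≤+ m≤1+k) (0≤deficit y) (i<j⇒suc[i]≤j k/[1+k]<d)

  bounded-colouring : ∀ k d → 1ℚ ℚ.- inv (suc k) ℚ.< d →
    ∃ λ C → ∀ G → LocallyPartite k 2 G → MinDegreeAtLeast G d → Colourable G C
  bounded-colouring k d t<d = C , go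
    where
    P C : ℕ
    P = ↧ₙ d ℕ.^ suc (suc k)
    -- This is `colours` with the denominator of `d` for `q`, written out because it must be fixed
    -- before the graph.
    C = suc (2 ℕ.* P) ℕ.^ ((2 ℕ.* (P ℕ.* P)) ℕ.* (2 ℕ.* (P ℕ.* P)))
    0<↧ₙ : 0 ℕ.< ↧ₙ d
    0<↧ₙ = ℕ.>-nonZero⁻¹ (↧ₙ d)
    go : ∀ G → LocallyPartite k 2 G → MinDegreeAtLeast G d → Colourable G C
    -- The sampling needs a vertex, so the empty graph is separate.
    go record { n = zero } _ _ = (λ ()) , λ ()
    go G@record { n = suc _ } loc md = colour zero 0<↧ₙ , colour-proper zero 0<↧ₙ
      where open UpperBound G k (↧ₙ d) loc (common-nbhd-large G k d (threshold-< k d t<d) md)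

  -- The colour of the extra clique vertex is not used on its neighbourhood.
  LocallyPartite-suc : ∀ {a b G} → LocallyPartite a (suc (suc b)) G → LocallyPartite (suc a) (suc b) G
  LocallyPartite-suc {a} {b} {G} loc K clique
    with loc (K ∘ suc) (λ i j i≢j → clique (suc i) (suc j) (i≢j ∘ Finₚ.suc-injective))
  ... | c , proper = c′ , proper′
    where
    v : Fin (n G)
    v = K zero
    avoids : ∀ u → CommonNbhd G K u → c v ≢ c u
    avoids u u∈ = proper v u (λ i → clique (suc i) zero (λ ())) (u∈ ∘ suc) (u∈ zero)
    c′ : Fin (n G) → Fin (suc b)
    c′ u with c v Fin.≟ c u
    ... | yes _   = zero
    ... | no v≢u  = Fin.punchOut v≢u
    proper′ : ∀ u w → CommonNbhd G K u → CommonNbhd G K w → adj G u w ≡ true → c′ u ≢ c′ w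
    proper′ u w u∈ w∈ uw with c v Fin.≟ c u | c v Fin.≟ c w
    ... | yes e   | _       = λ _ → avoids u u∈ e
    ... | no _    | yes e   = λ _ → avoids w w∈ e
    ... | no v≢u  | no v≢w  = λ e → proper u w (u∈ ∘ suc) (w∈ ∘ suc) uw (Finₚ.punchOut-injective v≢u v≢w e)

  LocallyPartite-+ : ∀ j {a b G} → LocallyPartite a (j ℕ.+ suc b) G → LocallyPartite (j ℕ.+ a) (suc b) G
  LocallyPartite-+ zero    loc = loc
  LocallyPartite-+ (suc j) {a} {b} {G} loc = LocallyPartite-suc {j ℕ.+ a} {b} {G}
    (LocallyPartite-+ j {a} {suc b} {G} (subst (λ z → LocallyPartite a z G) (sym (ℕₚ.+-suc j (suc b))) loc))

  -- Shift graphs and random markings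

  does-true : ∀ {P : Set} (p? : Dec P) → does p? ≡ true → P
  does-true (yes p) _ = p

  -- The exponential is applied to the argument to match the induction, in which a colouring with
  -- `C` colours is replaced by one with `2 ^ C`.
  tower : ℕ → ℕ → ℕ
  tower zero    C = C
  tower (suc r) C = tower r (2 ℕ.^ C)

  module _ {N : ℕ} where

    Increasing : ∀ {r} → Vec (Fin N) r → Set
    Increasing []           = ⊤
    Increasing (x ∷ [])     = ⊤
    Increasing (x ∷ y ∷ xs) = x Fin.< y × Increasing (y ∷ xs)

    increasing? : ∀ {r} (x : Vec (Fin N) r) → Dec (Increasing x)
    increasing? []           = yes tt
    increasing? (x ∷ [])     = yes tt
    increasing? (x ∷ y ∷ xs) = (x Finₚ.<? y) ×-dec increasing? (y ∷ xs)

    ShiftColouring : ∀ r C → (Vec (Fin N) (suc r) → Fin C) → Set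
    ShiftColouring r C c = ∀ (e : Vec (Fin N) (suc (suc r))) → Increasing e → c (init e) ≢ c (tail e)

    predecessor? : ∀ {r C} (c : Vec (Fin N) (suc (suc r)) → Fin C) x κ →
                   Dec (∃ λ y → Increasing (y ∷ x) × c (y ∷ x) ≡ κ)
    predecessor? c x κ = Finₚ.any? (λ y → increasing? (y ∷ x) ×-dec (c (y ∷ x) Fin.≟ κ))

    toBit : Bool → Fin 2
    toBit true  = suc zero
    toBit false = zero

    toBit-injective : ∀ {x y} → toBit x ≡ toBit y → x ≡ y
    toBit-injective {true}  {true}  _ = refl
    toBit-injective {false} {false} _ = refl

    -- Longer tuples are the arcs between shorter ones, from `init` to `tail`. As in the classical
    -- bound for line digraphs, a vertex receives the set of colours of its incoming arcs, coded as
    -- a number.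
    palette : ∀ {r C} (c : Vec (Fin N) (suc (suc r)) → Fin C) → Vec (Fin N) (suc r) → Fin (2 ℕ.^ C)
    palette c x = Fin.funToFin (λ κ → toBit (does (predecessor? c x κ)))

    -- If init e and tail e had the same palette, the colour of e would occur on
    -- some y ∷ init e, which the shift relation joins to e.
    palette-proper : ∀ {r C} c → ShiftColouring (suc r) C c → ShiftColouring r (2 ℕ.^ C) (palette c)
    palette-proper c proper e@(e₁ ∷ e₂ ∷ es) inc same
      with does-true (predecessor? c (init e) (c e)) (trans bits (dec-true (predecessor? c (tail e) (c e)) (e₁ , inc , refl)))
      where
      bit : ∀ x → Fin.finToFun (palette c x) (c e) ≡ toBit (does (predecessor? c x (c e)))
      bit x = Finₚ.finToFun-funToFin (λ κ → toBit (does (predecessor? c x κ))) (c e)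
      bits : does (predecessor? c (init e) (c e)) ≡ does (predecessor? c (tail e) (c e))
      bits = toBit-injective (trans (sym (bit (init e)))
        (trans (cong (λ z → Fin.finToFun z (c e)) same) (bit (tail e))))
    ... | y , (y<e₁ , _) , ceq = proper (y ∷ e) (y<e₁ , inc) ceq

    -- Palettes shorten the tuples one entry at a time. For single entries the shift graph is
    -- complete, so the colouring is injective.
    shift-uncolourable : ∀ r {C} c → ShiftColouring r C c → N ℕ.≤ tower r C
    shift-uncolourable zero    {C} c proper = Finₚ.injective⇒≤ {f = λ i → c (i ∷ [])} injective
      where
      injective : ∀ {i j} → c (i ∷ []) ≡ c (j ∷ []) → i ≡ j
      injective {i} {j} e with Finₚ.<-cmp i j
      ... | tri< i<j _ _ = ⊥-elim (proper (i ∷ j ∷ []) (i<j , tt) e)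
      ... | tri≈ _ i≡j _ = i≡j
      ... | tri> _ _ j<i = ⊥-elim (proper (j ∷ i ∷ []) (j<i , tt) (sym e))
    shift-uncolourable (suc r) c proper = shift-uncolourable r (palette c) (palette-proper c proper)

    Increasing-init : ∀ {r} (e : Vec (Fin N) (suc r)) → Increasing e → Increasing (init e)
    Increasing-init (x ∷ [])         _           = tt
    Increasing-init (x ∷ y ∷ [])     _           = tt
    Increasing-init (x ∷ y ∷ z ∷ es) (x<y , inc) = x<y , Increasing-init (y ∷ z ∷ es) inc

    Arc : ∀ {r} → Vec (Fin N) (suc (suc r)) → Vec (Fin N) (suc (suc r)) → Set
    Arc x y = Increasing x × Increasing y × tail x ≡ init y

    arc? : ∀ {r} (x y : Vec (Fin N) (suc (suc r))) → Dec (Arc x y)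
    arc? x y = increasing? x ×-dec increasing? y ×-dec Vecₚ.≡-dec Fin._≟_ (tail x) (init y)

    Arc-init-tail : ∀ {r} (e : Vec (Fin N) (suc (suc (suc r)))) → Increasing e → Arc (init e) (tail e)
    Arc-init-tail e@(_ ∷ _ ∷ _ ∷ _) inc = Increasing-init e inc , proj₂ inc , refl

    second : ∀ {r} → Vec (Fin N) (suc (suc r)) → Fin N
    second (_ ∷ y ∷ _) = y

    head<second : ∀ {r} (x : Vec (Fin N) (suc (suc r))) → Increasing x → head x Fin.< second x
    head<second (_ ∷ _ ∷ _) (x<y , _) = x<y

    Arc-second : ∀ {r} {x y : Vec (Fin N) (suc (suc r))} → Arc x y → second x ≡ head y
    Arc-second {x = _ ∷ _ ∷ _} {_ ∷ _ ∷ _} (_ , _ , e) = cong head e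

    Arc-head : ∀ {r} {x y : Vec (Fin N) (suc (suc r))} → Arc x y → head x Fin.< head y
    Arc-head {x = x} {y} xy = subst (head x Fin.<_) (Arc-second {x = x} {y} xy) (head<second x (proj₁ xy))

    Adjacent : ∀ {r} → Vec (Fin N) (suc (suc r)) → Vec (Fin N) (suc (suc r)) → Set
    Adjacent x y = Arc x y ⊎ Arc y x

    adjacent? : ∀ {r} (x y : Vec (Fin N) (suc (suc r))) → Dec (Adjacent x y)
    adjacent? x y = arc? x y ⊎-dec arc? y x

    -- Heads increase along arcs, so no triangle is cyclic. In a transitive one the source has two
    -- joined out-neighbours, but both have the second entry of the source as their head.
    triangle-free : ∀ {r} (x y z : Vec (Fin N) (suc (suc r))) → Adjacent x y → Adjacent x z → ¬ Arc y z
    triangle-free x y z (inj₁ xy) (inj₁ xz) yz =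
      Finₚ.<-irrefl (trans (sym (Arc-second {x = x} {y} xy)) (Arc-second {x = x} {z} xz)) (Arc-head {x = y} {z} yz)
    triangle-free x y z (inj₁ xy) (inj₂ zx) yz =
      Finₚ.<-asym (Arc-head {x = x} {y} xy) (Finₚ.<-trans (Arc-head {x = y} {z} yz) (Arc-head {x = z} {x} zx))
    triangle-free x y z (inj₂ yx) (inj₁ xz) yz =
      Finₚ.<-irrefl (trans (sym (Arc-second {x = y} {x} yx)) (Arc-second {x = y} {z} yz)) (Arc-head {x = x} {z} xz)
    triangle-free x y z (inj₂ yx) (inj₂ zx) yz =
      Finₚ.<-irrefl (trans (sym (Arc-second {x = y} {z} yz)) (trans (Arc-second {x = y} {x} yx) (sym (Arc-second {x = z} {x} zx))))
        (head<second z (proj₁ zx))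

  -- Marks of a labelling and their frequency

  isZero : ∀ {k} → Fin (suc k) → Bool
  isZero zero    = true
  isZero (suc _) = false

  module _ {N k : ℕ} (f : Vec (Fin (suc k)) N) where

    marked : Fin N → Bool
    marked x = isZero (lookup f x)

    hasMark : ∀ {r} → Vec (Fin N) r → Bool
    hasMark []       = false
    hasMark (x ∷ xs) = marked x ∨ hasMark xs

    -- The parity of the position of the first mark; the value at `[]` is a default reached only
    -- when there is no mark.
    markParity : ∀ {r} → Vec (Fin N) r → Bool
    markParity []       = false
    markParity (x ∷ xs) = if marked x then false else not (markParity xs)

    good : ∀ {r} → Vec (Fin N) (suc r) → Bool
    good (x ∷ xs) = not (marked x) ∧ hasMark xs

    markParity-init : ∀ {r} (y : Vec (Fin N) (suc r)) → hasMark (init y) ≡ true → markParity (init y) ≡ markParity y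
    markParity-init (y₁ ∷ y₂ ∷ ys) h with marked y₁
    ... | true  = refl
    ... | false = cong not (markParity-init (y₂ ∷ ys) h)

    -- Passing from `x` to `y` drops an unmarked first entry and appends an entry behind a mark, so
    -- the first mark moves forward by exactly one place. Only `x` has to be good.
    markParity-Arc : ∀ {r} (x y : Vec (Fin N) (suc (suc r))) → Arc x y → good x ≡ true → markParity x ≡ not (markParity y)
    markParity-Arc (x ∷ xs) y (_ , _ , e) g with marked x
    ... | false = cong not (trans (cong markParity e) (markParity-init y (subst (λ z → hasMark z ≡ true) e g)))

  -- Independence of the label at `x` from the other labels, as an identity between counts.
  resample : ∀ {A : Set} (as : List A) {N} (x : Fin N) (g : A → ℤ) (h : Vec A N → ℤ) →
    (∀ f a → h (f [ x ]≔ a) ≡ h f) →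
    size as * ∑ (tuples as N) (λ f → g (lookup f x) * h f) ≡ ∑ as g * ∑ (tuples as N) h
  resample as {suc N} zero g h indep = begin
    size as * ∑ (tuples as (suc N)) (λ f → g (lookup f zero) * h f)
      ≡⟨ cong (size as *_) (∑-product _∷_ as fs _) ⟩
    size as * ∑ as (λ a → ∑ fs (λ f → g a * h (a ∷ f)))
      ≡⟨ sym (∑-* as (size as) _) ⟩
    ∑ as (λ a → size as * ∑ fs (λ f → g a * h (a ∷ f)))
      ≡⟨ ∑-cong as (λ a → trans (cong (size as *_) (∑-* fs (g a) _)) (trans (rotate (size as) (g a) _)
           (cong (λ z → z * g a) (trans (sym (∑-* fs (size as) _)) (trans (∑-cong fs (all-heads a)) (∑-swap fs as _)))))) ⟩
    ∑ as (λ a → H * g a)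
      ≡⟨ ∑-* as H g ⟩
    H * ∑ as g
      ≡⟨ *-comm H (∑ as g) ⟩
    ∑ as g * H
      ≡⟨ cong (∑ as g *_) (sym (∑-product _∷_ as fs h)) ⟩
    ∑ as g * ∑ (tuples as (suc N)) h ∎
    where
    open ≡-Reasoning
    fs : List (Vec _ N)
    fs = tuples as N
    H : ℤ
    H = ∑ as (λ b → ∑ fs (λ f → h (b ∷ f)))
    rotate : ∀ s g t → s * (g * t) ≡ s * t * g
    rotate = solve-∀
    all-heads : ∀ a f → size as * h (a ∷ f) ≡ ∑ as (λ b → h (b ∷ f))
    all-heads a f = trans (sym (∑-const as (h (a ∷ f)))) (∑-cong as (λ b → sym (indep (a ∷ f) b)))
  resample as {suc N} (suc x) g h indep = begin
    size as * ∑ (tuples as (suc N)) (λ f → g (lookup f (suc x)) * h f)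
      ≡⟨ cong (size as *_) (∑-product _∷_ as fs _) ⟩
    size as * ∑ as (λ a → ∑ fs (λ f → g (lookup f x) * h (a ∷ f)))
      ≡⟨ sym (∑-* as (size as) _) ⟩
    ∑ as (λ a → size as * ∑ fs (λ f → g (lookup f x) * h (a ∷ f)))
      ≡⟨ ∑-cong as (λ a → resample as x g (λ f → h (a ∷ f)) (λ f → indep (a ∷ f))) ⟩
    ∑ as (λ a → ∑ as g * ∑ fs (λ f → h (a ∷ f)))
      ≡⟨ ∑-* as (∑ as g) _ ⟩
    ∑ as g * ∑ as (λ a → ∑ fs (λ f → h (a ∷ f)))
      ≡⟨ cong (∑ as g *_) (sym (∑-product _∷_ as fs h)) ⟩
    ∑ as g * ∑ (tuples as (suc N)) h ∎
    where
    open ≡-Reasoning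
    fs : List (Vec _ N)
    fs = tuples as N

  size-allFin : ∀ m → size (allFin m) ≡ + m
  size-allFin m = cong +_ (length-tabulate {n = m} id)

  ∑-const-tabulate : ∀ {A : Set} {m} (h : Fin m → A) {f : A → ℤ} c → (∀ i → f (h i) ≡ c) → ∑ (tabulate h) f ≡ + m * c
  ∑-const-tabulate {m = zero}  h c e = sym (*-zeroˡ c)
  ∑-const-tabulate {m = suc m} h c e = trans (cong₂ _+_ (e zero) (∑-const-tabulate (h ∘ suc) c (e ∘ suc))) (sym (suc-* (+ m) c))

  -- Bernoulli's inequality for `(1 + 1/k)^r` with denominators cleared.
  bernoulli : ∀ k r → k ℕ.^ r ℕ.* (k ℕ.+ r) ℕ.≤ suc k ℕ.^ r ℕ.* k
  bernoulli k zero    = ℕₚ.≤-reflexive (cong (1 ℕ.*_) (ℕₚ.+-identityʳ k))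
  bernoulli k (suc r) = begin
    k ℕ.* k ℕ.^ r ℕ.* (k ℕ.+ suc r)             ≤⟨ ℕₚ.m≤m+n _ (k ℕ.^ r ℕ.* r) ⟩
    k ℕ.* k ℕ.^ r ℕ.* (k ℕ.+ suc r) ℕ.+ k ℕ.^ r ℕ.* r ≡⟨ eq k (k ℕ.^ r) r ⟩
    suc k ℕ.* (k ℕ.^ r ℕ.* (k ℕ.+ r))           ≤⟨ ℕₚ.*-monoʳ-≤ (suc k) (bernoulli k r) ⟩
    suc k ℕ.* (suc k ℕ.^ r ℕ.* k)               ≡⟨ sym (ℕₚ.*-assoc (suc k) (suc k ℕ.^ r) k) ⟩
    suc k ℕ.* suc k ℕ.^ r ℕ.* k ∎
    where
    open ℕₚ.≤-Reasoning
    eq : ∀ k p r → k ℕ.* p ℕ.* (k ℕ.+ suc r) ℕ.+ p ℕ.* r ≡ suc k ℕ.* (p ℕ.* (k ℕ.+ r))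
    eq = ℕ-solve-∀

  -- Bernoulli at exponent `k * k` already gives the factor `1 + k`; the extra entry in the exponent
  -- absorbs a remaining `k` without division.
  power-ratio : ∀ k .{{_ : ℕ.NonZero k}} → suc k ℕ.* k ℕ.^ suc (k ℕ.* k) ℕ.≤ suc k ℕ.^ suc (k ℕ.* k)
  power-ratio k = begin
    suc k ℕ.* (k ℕ.* k ℕ.^ (k ℕ.* k))         ≡⟨ eq k (k ℕ.^ (k ℕ.* k)) ⟩
    k ℕ.^ (k ℕ.* k) ℕ.* (k ℕ.+ k ℕ.* k)       ≤⟨ bernoulli k (k ℕ.* k) ⟩
    suc k ℕ.^ (k ℕ.* k) ℕ.* k                 ≤⟨ ℕₚ.*-monoʳ-≤ (suc k ℕ.^ (k ℕ.* k)) (ℕₚ.n≤1+n k) ⟩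
    suc k ℕ.^ (k ℕ.* k) ℕ.* suc k             ≡⟨ ℕₚ.*-comm (suc k ℕ.^ (k ℕ.* k)) (suc k) ⟩
    suc k ℕ.* suc k ℕ.^ (k ℕ.* k) ∎
    where
    open ℕₚ.≤-Reasoning
    eq : ∀ k p → suc k ℕ.* (k ℕ.* p) ≡ p ℕ.* (k ℕ.+ k ℕ.* k)
    eq = ℕ-solve-∀

  module _ {N : ℕ} (k : ℕ) .{{_ : ℕ.NonZero k}} where

    labellings : List (Vec (Fin (suc k)) N)
    labellings = tuples (allFin (suc k)) N

    private
      F M : ℤ
      F = size labellings
      M = + suc k

    ∑-isZero : ∑ (allFin (suc k)) (λ a → ⟦ isZero a ⟧) ≡ 1ℤ
    ∑-isZero = trans (+-congˡ 1ℤ (trans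
      (∑-const-tabulate {m = k} suc {λ a → ⟦ isZero a ⟧} 0ℤ (λ _ → refl)) (*-zeroʳ (+ k)))) (+-identityʳ 1ℤ)

    ∑-nonZero : ∑ (allFin (suc k)) (λ a → ⟦ not (isZero a) ⟧) ≡ + k
    ∑-nonZero = trans (+-identityˡ _) (trans
      (∑-const-tabulate {m = k} suc {λ a → ⟦ not (isZero a) ⟧} 1ℤ (λ _ → refl)) (*-identityʳ (+ k)))

    marked-count : ∀ x → M * ∑ labellings (λ f → ⟦ marked f x ⟧) ≡ F
    marked-count x = begin
      M * ∑ labellings (λ f → ⟦ marked f x ⟧)
        ≡⟨ cong₂ _*_ (sym (size-allFin (suc k))) (∑-cong labellings (λ f → sym (*-identityʳ ⟦ marked f x ⟧))) ⟩
      size (allFin (suc k)) * ∑ labellings (λ f → ⟦ marked f x ⟧ * 1ℤ)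
        ≡⟨ resample (allFin (suc k)) x (λ a → ⟦ isZero a ⟧) (λ _ → 1ℤ) (λ _ _ → refl) ⟩
      ∑ (allFin (suc k)) (λ a → ⟦ isZero a ⟧) * ∑ labellings (λ _ → 1ℤ)
        ≡⟨ cong₂ _*_ ∑-isZero (sym (size≡∑1 labellings)) ⟩
      1ℤ * F ≡⟨ *-identityˡ F ⟩
      F ∎
      where open ≡-Reasoning

    -- The later entries exceed `x`, so relabelling `x` affects none of them. This is the
    -- independence required by `resample`.
    hasMark-update : ∀ {r} x (xs : Vec (Fin N) r) → Increasing (x ∷ xs) → ∀ (f : Vec (Fin (suc k)) N) a →
                     hasMark (f [ x ]≔ a) xs ≡ hasMark f xs
    hasMark-update x []           _           f a = refl
    hasMark-update x (y ∷ [])     (x<y , _)   f a =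
      cong (λ z → isZero z ∨ false) (Vecₚ.lookup∘update′ (λ y≡x → Finₚ.<-irrefl (sym y≡x) x<y) f a)
    hasMark-update x (y ∷ z ∷ ys) (x<y , y<z , inc) f a = cong₂ (λ b c → isZero b ∨ c)
      (Vecₚ.lookup∘update′ (λ y≡x → Finₚ.<-irrefl (sym y≡x) x<y) f a)
      (hasMark-update x (z ∷ ys) (Finₚ.<-trans x<y y<z , inc) f a)

    Increasing-tail : ∀ {r} x (xs : Vec (Fin N) r) → Increasing (x ∷ xs) → Increasing xs
    Increasing-tail x []       _         = tt
    Increasing-tail x (y ∷ xs) (_ , inc) = inc

    unmarked-count : ∀ {r} (xs : Vec (Fin N) r) → Increasing xs →
      + (suc k ℕ.^ r) * ∑ labellings (λ f → ⟦ not (hasMark f xs) ⟧) ≡ + (k ℕ.^ r) * F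
    unmarked-count [] _ = cong (1ℤ *_) (sym (size≡∑1 labellings))
    unmarked-count {suc r} (x ∷ xs) inc = begin
      + (suc k ℕ.* suc k ℕ.^ r) * ∑ labellings (λ f → ⟦ not (marked f x ∨ hasMark f xs) ⟧)
        ≡⟨ cong₂ _*_ (pos-* (suc k) (suc k ℕ.^ r)) (∑-cong labellings (λ f → split (marked f x) (hasMark f xs))) ⟩
      M * + (suc k ℕ.^ r) * S₁
        ≡⟨ rotate M (+ (suc k ℕ.^ r)) S₁ ⟩
      + (suc k ℕ.^ r) * (M * S₁)
        ≡⟨ cong (λ z → + (suc k ℕ.^ r) * (z * S₁)) (sym (size-allFin (suc k))) ⟩
      + (suc k ℕ.^ r) * (size (allFin (suc k)) * S₁)
        ≡⟨ cong (+ (suc k ℕ.^ r) *_) (resample (allFin (suc k)) x (λ a → ⟦ not (isZero a) ⟧) _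
             (λ f a → cong (λ b → ⟦ not b ⟧) (hasMark-update x xs inc f a))) ⟩
      + (suc k ℕ.^ r) * (∑ (allFin (suc k)) (λ a → ⟦ not (isZero a) ⟧) * S₂)
        ≡⟨ cong (λ z → + (suc k ℕ.^ r) * (z * S₂)) ∑-nonZero ⟩
      + (suc k ℕ.^ r) * (+ k * S₂)
        ≡⟨ rotate′ (+ (suc k ℕ.^ r)) (+ k) S₂ ⟩
      + k * (+ (suc k ℕ.^ r) * S₂)
        ≡⟨ cong (+ k *_) (unmarked-count xs (Increasing-tail x xs inc)) ⟩
      + k * (+ (k ℕ.^ r) * F)
        ≡⟨ sym (*-assoc (+ k) (+ (k ℕ.^ r)) F) ⟩
      + k * + (k ℕ.^ r) * F
        ≡⟨ cong (_* F) (sym (pos-* k (k ℕ.^ r))) ⟩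
      + (k ℕ.* k ℕ.^ r) * F ∎
      where
      open ≡-Reasoning
      split : ∀ b c → ⟦ not (b ∨ c) ⟧ ≡ ⟦ not b ⟧ * ⟦ not c ⟧
      split true  c = refl
      split false c = sym (*-identityˡ ⟦ not c ⟧)
      S₁ S₂ : ℤ
      S₁ = ∑ labellings (λ f → ⟦ not (marked f x) ⟧ * ⟦ not (hasMark f xs) ⟧)
      S₂ = ∑ labellings (λ f → ⟦ not (hasMark f xs) ⟧)
      rotate : ∀ a b c → a * b * c ≡ b * (a * c)
      rotate = solve-∀
      rotate′ : ∀ a b c → a * (b * c) ≡ b * (a * c)
      rotate′ = solve-∀

    unmarked-rare : (xs : Vec (Fin N) (suc (k ℕ.* k))) → Increasing xs →
      M * ∑ labellings (λ f → ⟦ not (hasMark f xs) ⟧) ≤ F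
    unmarked-rare xs inc = *-cancelˡ-≤-pos _ _ (+ (suc k ℕ.^ t)) {{positive (+<+ (ℕₚ.m^n>0 (suc k) t))}} (begin
      + (suc k ℕ.^ t) * (M * S)    ≡⟨ rotate (+ (suc k ℕ.^ t)) M S ⟩
      M * (+ (suc k ℕ.^ t) * S)    ≡⟨ cong (M *_) (unmarked-count xs inc) ⟩
      M * (+ (k ℕ.^ t) * F)        ≡⟨ sym (*-assoc M (+ (k ℕ.^ t)) F) ⟩
      M * + (k ℕ.^ t) * F          ≡⟨ cong (_* F) (sym (pos-* (suc k) (k ℕ.^ t))) ⟩
      + (suc k ℕ.* k ℕ.^ t) * F    ≤⟨ *-monoʳ-0≤ {F} 0≤pos (+≤+ (power-ratio k)) ⟩
      + (suc k ℕ.^ t) * F ∎)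
      where
      open ≤-Reasoning
      t : ℕ
      t = suc (k ℕ.* k)
      S : ℤ
      S = ∑ labellings (λ f → ⟦ not (hasMark f xs) ⟧)
      rotate : ∀ a b c → a * (b * c) ≡ b * (a * c)
      rotate = solve-∀

    -- A union bound: a labelling fails if it marks the first entry or none of the remaining
    -- `k * k + 1`, each of probability at most `1/(k+1)`.
    good-frequent : (x : Vec (Fin N) (suc (suc (k ℕ.* k)))) → Increasing x →
      M * F ≤ M * ∑ labellings (λ f → ⟦ good f x ⟧) + + 2 * F
    good-frequent (x ∷ xs) inc = begin
      M * F
        ≡⟨ cong (M *_) (size≡∑1 labellings) ⟩
      M * ∑ labellings (λ _ → 1ℤ)
        ≤⟨ *-monoˡ-0≤ {M} 0≤pos (∑-mono labellings (λ f → pointwise (marked f x) (hasMark f xs))) ⟩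
      M * ∑ labellings (λ f → ⟦ good f (x ∷ xs) ⟧ + (⟦ marked f x ⟧ + ⟦ not (hasMark f xs) ⟧))
        ≡⟨ cong (M *_) (trans (∑-+ labellings _ _) (+-congˡ S₁ (∑-+ labellings _ _))) ⟩
      M * (S₁ + (S₂ + S₃))
        ≡⟨ distribute M S₁ S₂ S₃ ⟩
      M * S₁ + (M * S₂ + M * S₃)
        ≤⟨ +-monoʳ-≤ (M * S₁) (+-mono-≤ (≤-reflexive (marked-count x)) (unmarked-rare xs (Increasing-tail x xs inc))) ⟩
      M * S₁ + (F + F)
        ≡⟨ +-congˡ (M * S₁) (double F) ⟩
      M * S₁ + + 2 * F ∎
      where
      open ≤-Reasoning
      S₁ S₂ S₃ : ℤ
      S₁ = ∑ labellings (λ f → ⟦ good f (x ∷ xs) ⟧)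
      S₂ = ∑ labellings (λ f → ⟦ marked f x ⟧)
      S₃ = ∑ labellings (λ f → ⟦ not (hasMark f xs) ⟧)
      pointwise : ∀ b c → 1ℤ ≤ ⟦ not b ∧ c ⟧ + (⟦ b ⟧ + ⟦ not c ⟧)
      pointwise true  true  = ≤-refl
      pointwise true  false = +≤+ (s≤s z≤n)
      pointwise false true  = ≤-refl
      pointwise false false = ≤-refl
      distribute : ∀ m a b c → m * (a + (b + c)) ≡ m * a + (m * b + m * c)
      distribute = solve-∀
      double : ∀ a → a + a ≡ + 2 * a
      double = solve-∀

  -- Locally partite graphs below the threshold

  not-does : ∀ {P : Set} (p? : Dec P) → not (does p?) ≡ true → ¬ P
  not-does (no ¬p) _ = ¬p

  ∑-tabulate-∘ : ∀ {A B : Set} {m} (g : A → B) (h : Fin m → A) f → ∑ (tabulate (g ∘ h)) f ≡ ∑ (tabulate h) (f ∘ g)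
  ∑-tabulate-∘ {m = zero}  g h f = refl
  ∑-tabulate-∘ {m = suc m} g h f = +-congˡ (f (g (h zero))) (∑-tabulate-∘ g (h ∘ suc) f)

  ∑-others : ∀ {m} (i : Fin (suc m)) → ∑ (allFin (suc m)) (λ j → ⟦ not (does (i Fin.≟ j)) ⟧) ≡ + m
  ∑-others {m} zero = trans (+-identityˡ _)
    (trans (∑-const-tabulate {m = m} suc {λ j → ⟦ not (does (zero {n = m} Fin.≟ j)) ⟧} 1ℤ (λ _ → refl)) (*-identityʳ (+ m)))
  ∑-others {suc m} (suc i) = +-congˡ 1ℤ (trans
    (∑-tabulate-∘ {Fin (suc m)} {Fin (suc (suc m))} suc id (λ j → ⟦ not (does (suc i Fin.≟ j)) ⟧)) (∑-others i))

  module Construction (N b k M : ℕ) .{{_ : ℕ.NonZero k}} where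

    Tuple Labelling : Set
    Tuple     = Vec (Fin N) (suc (suc (k ℕ.* k)))
    Labelling = Vec (Fin (suc k)) N

    data Vertex : Set where
      tup : Tuple → Vertex
      lab : Fin (suc b) → Labelling → Fin M → Vertex

    labels : List Labelling
    labels = labellings k

    -- A tuple that is not increasing has no neighbour among the tuples, so every
    -- labelling may see it.
    compatible : Labelling → Tuple → Bool
    compatible f x = not (does (increasing? x)) ∨ good f x

    -- Part `zero` is the one that sees no tuples, which frees its index as a colour for tuples.
    _~_ : Vertex → Vertex → Bool
    tup x     ~ tup y     = does (adjacent? x y)
    tup x     ~ lab i f _ = not (does (zero Fin.≟ i)) ∧ compatible f x
    lab i f _ ~ tup x     = not (does (zero Fin.≟ i)) ∧ compatible f x
    lab i _ _ ~ lab j _ _ = not (does (i Fin.≟ j))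

    ~-sym : ∀ u v → u ~ v ≡ v ~ u
    ~-sym (tup x)     (tup y)     = Boolₚ.∨-comm (does (arc? x y)) (does (arc? y x))
    ~-sym (tup x)     (lab i f _) = refl
    ~-sym (lab i f _) (tup x)     = refl
    ~-sym (lab i _ _) (lab j _ _) = cong not (does-sym (i Fin.≟ j) (j Fin.≟ i))
      where
      does-sym : Dec (i ≡ j) → Dec (j ≡ i) → does (i Fin.≟ j) ≡ does (j Fin.≟ i)
      does-sym (yes e) _ = trans (dec-true (i Fin.≟ j) e) (sym (dec-true (j Fin.≟ i) (sym e)))
      does-sym (no ¬e) _ = trans (dec-false (i Fin.≟ j) ¬e) (sym (dec-false (j Fin.≟ i) (¬e ∘ sym)))

    ~-irrefl : ∀ v → v ~ v ≡ false
    ~-irrefl (tup x) = dec-false (adjacent? x x) λ where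
      (inj₁ xx) → Finₚ.<-irrefl refl (Arc-head {x = x} {x} xx)
      (inj₂ xx) → Finₚ.<-irrefl refl (Arc-head {x = x} {x} xx)
    ~-irrefl (lab i _ _) = cong not (dec-true (i Fin.≟ i) refl)

    -- Around a labelling of part `i`, no labelling has colour `i`, and those of colour `zero` see
    -- no tuples. Both colours are thus available to the tuples, which are split by mark parity.
    nbhd-colour : Vertex → Vertex → Fin (suc b)
    nbhd-colour _           (lab j _ _) = j
    nbhd-colour (tup _)     (tup y)     = zero
    nbhd-colour (lab i f _) (tup y)     = if markParity f y then i else zero

    private
      index≢0 : ∀ {i : Fin (suc b)} f x → not (does (zero Fin.≟ i)) ∧ compatible f x ≡ true → zero ≢ i
      index≢0 {i} f x e = not-does (zero Fin.≟ i) (∧-splitˡ e)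

      compatible-good : ∀ (i : Fin (suc b)) f x → not (does (zero Fin.≟ i)) ∧ compatible f x ≡ true → Increasing x → good f x ≡ true
      compatible-good i f x e inc with ∧-splitʳ {not (does (zero Fin.≟ i))} e
      ... | c rewrite dec-true (increasing? x) inc = c

      opposite : ∀ {i : Fin (suc b)} p q → zero ≢ i → p ≡ not q → (if p then i else zero) ≢ (if q then i else zero)
      opposite true  false 0≢i _ e = 0≢i (sym e)
      opposite false true  0≢i _ e = 0≢i e

      Arc-proper : ∀ i f y z → not (does (zero Fin.≟ i)) ∧ compatible f y ≡ true → Arc y z →
                   (if markParity f y then i else zero) ≢ (if markParity f z then i else zero)
      Arc-proper i f y z vy yz = opposite _ _ (index≢0 f y vy)
        (markParity-Arc f y z yz (compatible-good i f y vy (proj₁ yz)))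

      avoids : ∀ p (i j : Fin (suc b)) → i ≢ j → zero ≢ j → (if p then i else zero) ≢ j
      avoids true  i j i≢j 0≢j = i≢j
      avoids false i j i≢j 0≢j = 0≢j

    -- Around a tuple, two joined tuples would form a triangle. Around a labelling, the source of an
    -- arc is increasing and compatible, hence good, so the parities of its ends differ.
    nbhd-proper : ∀ v u w → v ~ u ≡ true → v ~ w ≡ true → u ~ w ≡ true → nbhd-colour v u ≢ nbhd-colour v w
    nbhd-proper (tup x) (tup y) (tup z) vu vw uw
      with does-true (adjacent? x y) vu | does-true (adjacent? x z) vw | does-true (adjacent? y z) uw
    ... | xy | xz | inj₁ yz = ⊥-elim (triangle-free x y z xy xz yz)
    ... | xy | xz | inj₂ zy = ⊥-elim (triangle-free x z y xz xy zy)
    nbhd-proper (tup _)     (tup y)     (lab j f _) vu vw uw = index≢0 f y uw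
    nbhd-proper (tup _)     (lab j f _) (tup y)     vu vw uw = index≢0 f y uw ∘ sym
    nbhd-proper (tup _)     (lab i _ _) (lab j _ _) vu vw uw = not-does (i Fin.≟ j) uw
    nbhd-proper (lab i f _) (tup y)     (tup z)     vu vw uw with does-true (adjacent? y z) uw
    ... | inj₁ yz = Arc-proper i f y z vu yz
    ... | inj₂ zy = Arc-proper i f z y vw zy ∘ sym
    nbhd-proper (lab i f _) (tup y)     (lab j g _) vu vw uw =
      avoids (markParity f y) i j (not-does (i Fin.≟ j) vw) (index≢0 g y uw)
    nbhd-proper (lab i f _) (lab j g _) (tup y)     vu vw uw =
      avoids (markParity f y) i j (not-does (i Fin.≟ j) vu) (index≢0 g y uw) ∘ sym
    nbhd-proper (lab _ _ _) (lab i _ _) (lab j _ _) vu vw uw = not-does (i Fin.≟ j) uw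

    allTuples : List Tuple
    allTuples = tuples (allFin N) (suc (suc (k ℕ.* k)))

    copies : List (Labelling × Fin M)
    copies = cartesianProductWith _,_ labels (allFin M)

    labs : List Vertex
    labs = cartesianProductWith (λ i p → lab i (proj₁ p) (proj₂ p)) (allFin (suc b)) copies

    vertices : List Vertex
    vertices = map tup allTuples ++ labs

    graph : Graph
    graph = record
      { n      = length vertices
      ; adj    = λ i j → List.lookup vertices i ~ List.lookup vertices j
      ; sym    = λ i j → ~-sym (List.lookup vertices i) (List.lookup vertices j)
      ; irrefl = λ i → ~-irrefl (List.lookup vertices i)
      }

    graph-local : LocallyPartite 1 (suc b) graph
    graph-local K _ = (λ u → nbhd-colour v (List.lookup vertices u)) ,
      λ u w u∈ w∈ uw → nbhd-proper v _ _ (u∈ zero) (w∈ zero) uw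
      where
      v : Vertex
      v = List.lookup vertices (K zero)

    graph-uncolourable : ∀ C → Colourable graph C → N ℕ.≤ tower (suc (k ℕ.* k)) C
    graph-uncolourable C (c , proper) = shift-uncolourable (suc (k ℕ.* k)) (c ∘ position) λ e inc →
      proper (position (init e)) (position (tail e)) (subst₂ (λ u w → u ~ w ≡ true)
        (lookup-index (tup∈ (init e))) (lookup-index (tup∈ (tail e)))
        (dec-true (adjacent? (init e) (tail e)) (inj₁ (Arc-init-tail e inc))))
      where
      tup∈ : ∀ x → tup x ∈ vertices
      tup∈ x = ∈-++⁺ˡ (∈-map⁺ tup (∈-tuples ∈-allFin x))
      position : Tuple → Fin (length vertices)
      position x = index (tup∈ x)

    private
      F S m : ℤ
      F = size labels
      S = F * + M
      m = + suc k

    order-graph : + order graph ≡ size allTuples + + suc b * S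
    order-graph = begin
      size vertices
        ≡⟨ size≡∑1 vertices ⟩
      ∑ vertices (λ _ → 1ℤ)
        ≡⟨ ∑-++ (map tup allTuples) labs _ ⟩
      ∑ (map tup allTuples) (λ _ → 1ℤ) + ∑ labs (λ _ → 1ℤ)
        ≡⟨ cong₂ _+_ (trans (∑-map tup allTuples _) (sym (size≡∑1 allTuples))) (sym (size≡∑1 labs)) ⟩
      size allTuples + size labs
        ≡⟨ +-congˡ (size allTuples) (trans (size-product _ (allFin (suc b)) copies) (cong₂ _*_ (size-allFin (suc b)) size-copies)) ⟩
      size allTuples + + suc b * S ∎
      where
      open ≡-Reasoning
      size-copies : size copies ≡ S
      size-copies = trans (size-product _,_ labels (allFin M)) (cong (F *_) (size-allFin M))

    degree-graph : ∀ v → + degree graph v ≡ ∑ vertices (λ u → ⟦ List.lookup vertices v ~ u ⟧)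
    degree-graph v = trans (sym (∑-tabulate (List.lookup vertices) (List.lookup vertices v ~_)))
      (cong (λ us → ∑ us (λ u → ⟦ List.lookup vertices v ~ u ⟧)) (tabulate-lookup vertices))

    private
      labs≤ : ∀ v → ∑ labs (λ u → ⟦ v ~ u ⟧) ≤ ∑ vertices (λ u → ⟦ v ~ u ⟧)
      labs≤ v = ≤-slack (∑ (map tup allTuples) (λ u → ⟦ v ~ u ⟧)) (∑-nonneg (map tup allTuples) (λ u → 0≤⟦⟧ (v ~ u)))
        (trans (∑-++ (map tup allTuples) labs _) (+-comm (∑ (map tup allTuples) (λ u → ⟦ v ~ u ⟧)) _))

      -- Covers both kinds of vertices: a tuple behaves like part `zero` with `p` its compatibility,
      -- and a labelling has `p` constantly true.
      ∑-labs : ∀ i (p : Labelling → Bool) {g : Vertex → ℤ} →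
        (∀ j f c → g (lab j f c) ≡ ⟦ not (does (i Fin.≟ j)) ∧ p f ⟧) →
        ∑ labs g ≡ + b * (∑ labels (λ f → ⟦ p f ⟧) * + M)
      ∑-labs i p {g} e = begin
        ∑ labs g
          ≡⟨ ∑-product _ (allFin (suc b)) copies g ⟩
        ∑ (allFin (suc b)) (λ j → ∑ copies (λ c → g (lab j (proj₁ c) (proj₂ c))))
          ≡⟨ ∑-cong (allFin (suc b)) (λ j → ∑-cong copies (λ c → e j (proj₁ c) (proj₂ c))) ⟩
        ∑ (allFin (suc b)) (λ j → ∑ copies (λ c → ⟦ not (does (i Fin.≟ j)) ∧ p (proj₁ c) ⟧))
          ≡⟨ ∑-cong (allFin (suc b)) (λ j → trans
               (trans (∑-cong copies (λ c → ⟦∧⟧ (not (does (i Fin.≟ j))) (p (proj₁ c)))) (∑-* copies ⟦ not (does (i Fin.≟ j)) ⟧ _))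
               (*-comm ⟦ not (does (i Fin.≟ j)) ⟧ _)) ⟩
        ∑ (allFin (suc b)) (λ j → ∑ copies (λ c → ⟦ p (proj₁ c) ⟧) * ⟦ not (does (i Fin.≟ j)) ⟧)
          ≡⟨ ∑-* (allFin (suc b)) (∑ copies (λ c → ⟦ p (proj₁ c) ⟧)) _ ⟩
        ∑ copies (λ c → ⟦ p (proj₁ c) ⟧) * ∑ (allFin (suc b)) (λ j → ⟦ not (does (i Fin.≟ j)) ⟧)
          ≡⟨ cong₂ _*_ ∑-copies (∑-others i) ⟩
        ∑ labels (λ f → ⟦ p f ⟧) * + M * + b
          ≡⟨ *-comm _ (+ b) ⟩
        + b * (∑ labels (λ f → ⟦ p f ⟧) * + M) ∎
        where
        open ≡-Reasoning
        ∑-copies : ∑ copies (λ c → ⟦ p (proj₁ c) ⟧) ≡ ∑ labels (λ f → ⟦ p f ⟧) * + M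
        ∑-copies = trans (∑-product _,_ labels (allFin M) _) (trans
          (∑-cong labels (λ f → trans (∑-const (allFin M) ⟦ p f ⟧) (cong (_* ⟦ p f ⟧) (size-allFin M))))
          (trans (∑-* labels (+ M) _) (*-comm (+ M) _)))

    compatible-frequent : ∀ x → m * F ≤ m * ∑ labels (λ f → ⟦ compatible f x ⟧) + + 2 * F
    compatible-frequent x with increasing? x
    ... | yes inc = good-frequent k x inc
    ... | no _    = ≤-slack (+ 2 * F) (0≤* {+ 2} {F} 0≤pos 0≤pos)
      (cong (λ z → m * z + + 2 * F) (sym (size≡∑1 labels)))

    -- Only neighbours among the labellings are counted. In the `b` parts open to it, a tuple misses
    -- at most a fraction `2/(k+1)` and a labelling misses nothing.
    degree-large : ∀ v → m * (+ b * S) ≤ m * + degree graph v + + 2 * (+ b * S)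
    degree-large v = subst (λ z → m * (+ b * S) ≤ m * z + + 2 * (+ b * S)) (sym (degree-graph v)) (bound (List.lookup vertices v))
      where
      open ≤-Reasoning
      bound : ∀ v → m * (+ b * S) ≤ m * ∑ vertices (λ u → ⟦ v ~ u ⟧) + + 2 * (+ b * S)
      bound (tup x) = begin
        m * (+ b * (F * + M))
          ≡⟨ eq₁ m (+ b) F (+ M) ⟩
        + b * + M * (m * F)
          ≤⟨ *-monoˡ-0≤ (0≤* {+ b} {+ M} 0≤pos 0≤pos) (compatible-frequent x) ⟩
        + b * + M * (m * G + + 2 * F)
          ≡⟨ eq₂ m (+ b) F (+ M) G ⟩
        m * (+ b * (G * + M)) + + 2 * (+ b * S)
          ≤⟨ +-monoˡ-≤ (+ 2 * (+ b * S)) (*-monoˡ-0≤ {m} 0≤pos (≤-trans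
               (≤-reflexive (sym (∑-labs zero (λ f → compatible f x) (λ _ _ _ → refl)))) (labs≤ (tup x)))) ⟩
        m * ∑ vertices (λ u → ⟦ tup x ~ u ⟧) + + 2 * (+ b * S) ∎
        where
        G : ℤ
        G = ∑ labels (λ f → ⟦ compatible f x ⟧)
        eq₁ : ∀ m b F M → m * (b * (F * M)) ≡ b * M * (m * F)
        eq₁ = solve-∀
        eq₂ : ∀ m b F M G → b * M * (m * G + + 2 * F) ≡ m * (b * (G * M)) + + 2 * (b * (F * M))
        eq₂ = solve-∀
      bound v@(lab i f c) = ≤-slack
        (m * (∑ vertices (λ u → ⟦ v ~ u ⟧) - + b * S) + + 2 * (+ b * S))
        (0≤+ (0≤* {m} 0≤pos (gap (≤-trans (≤-reflexive (sym labs-sum)) (labs≤ v))))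
             (0≤* {+ 2} 0≤pos (0≤* {+ b} {S} 0≤pos (0≤* {F} {+ M} 0≤pos 0≤pos))))
        (eq m (∑ vertices (λ u → ⟦ v ~ u ⟧)) (+ b * S))
        where
        labs-sum : ∑ labs (λ u → ⟦ v ~ u ⟧) ≡ + b * S
        labs-sum = trans (∑-labs i (λ _ → true) (λ j _ _ → cong ⟦_⟧ (sym (Boolₚ.∧-identityʳ (not (does (i Fin.≟ j)))))))
          (cong (λ z → + b * (z * + M)) (sym (size≡∑1 labels)))
        eq : ∀ m e s → m * e + + 2 * s ≡ m * s + (m * (e - s) + + 2 * s)
        eq = solve-∀

  -- The integer gap in `p/q < b/(b+1)` is worth `S`. The missed labellings cost at most half of it,
  -- since `4 q b ≤ m`, and the `w` tuples in the order at most the other half, since `2 p w ≤ S`.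
  degree-arithmetic : ∀ p q b m S w e → 0ℤ ≤ q → 1ℤ ≤ m → 0ℤ ≤ S →
    1ℤ + p * (1ℤ + b) ≤ b * q → m * (b * S) ≤ m * e + + 2 * (b * S) →
    + 4 * (q * b) ≤ m → + 2 * (p * w) ≤ S → p * (w + (1ℤ + b) * S) ≤ q * e
  degree-arithmetic p q b m S w e 0≤q 1≤m 0≤S h₁ h₂ h₃ h₄ =
    *-cancelˡ-≤-pos _ _ (+ 2 * m) {{positive (<-≤-trans (+<+ (s≤s z≤n)) (1≤* {+ 2} (+≤+ (s≤s z≤n)) 1≤m))}} (≤-slack
      (+ 2 * q * (m * e + + 2 * (b * S) - m * (b * S)) + (+ 2 * m * S * (b * q - (1ℤ + p * (1ℤ + b)))
        + (S * (m - + 4 * (q * b)) + m * (S - + 2 * (p * w)))))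
      (0≤+ (0≤* (0≤* {+ 2} 0≤pos 0≤q) (gap h₂)) (0≤+ (0≤* (0≤* (0≤* {+ 2} 0≤pos 0≤m) 0≤S) (gap h₁))
        (0≤+ (0≤* 0≤S (gap h₃)) (0≤* 0≤m (gap h₄)))))
      (eq p q b m S w e))
    where
    0≤m : 0ℤ ≤ m
    0≤m = ≤-trans 0≤pos 1≤m
    eq : ∀ p q b m S w e → + 2 * m * (q * e) ≡ + 2 * m * (p * (w + (1ℤ + b) * S))
       + (+ 2 * q * (m * e + + 2 * (b * S) - m * (b * S)) + (+ 2 * m * S * (b * q - (1ℤ + p * (1ℤ + b)))
        + (S * (m - + 4 * (q * b)) + m * (S - + 2 * (p * w)))))
    eq = solve-∀

  unbounded-below-threshold : ∀ b d → d ℚ.< 1ℚ ℚ.- inv (suc b) → ∀ C →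
    ∃ λ G → LocallyPartite 1 (suc b) G × MinDegreeAtLeast G d × ¬ Colourable G C
  unbounded-below-threshold b d d<t C = graph , graph-local , min-degree , uncolourable
    where
    k N w M : ℕ
    -- `k` keeps missed labellings cheap, `N` exceeds the tower bound for `C` colours, and `M` then
    -- makes each part outweigh the `w` tuples. The absolute value covers negative `d`.
    k = suc (4 ℕ.* (↧ₙ d ℕ.* b))
    N = suc (tower (suc (k ℕ.* k)) C)
    w = length (tuples (allFin N) (suc (suc (k ℕ.* k))))
    M = 2 ℕ.* (∣ ↥ d ∣ ℕ.* w)
    open Construction N b k M
    F : ℤ
    F = size (labellings {N} k)
    copies-suffice : + 2 * (↥ d * + w) ≤ F * + M
    copies-suffice = begin
      + 2 * (↥ d * + w)          ≤⟨ *-monoˡ-0≤ {+ 2} 0≤pos (*-monoʳ-0≤ {+ w} 0≤pos (i≤+∣i∣ (↥ d))) ⟩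
      + 2 * (+ ∣ ↥ d ∣ * + w)    ≡⟨ sym (trans (pos-* 2 (∣ ↥ d ∣ ℕ.* w)) (cong (+ 2 *_) (pos-* ∣ ↥ d ∣ w))) ⟩
      + M                        ≡⟨ sym (*-identityˡ (+ M)) ⟩
      1ℤ * + M                   ≤⟨ *-monoʳ-0≤ {+ M} 0≤pos (size-pos (∈-tuples ∈-allFin (Vec.replicate N zero))) ⟩
      F * + M ∎
      where
      open ≤-Reasoning
      i≤+∣i∣ : ∀ i → i ≤ + ∣ i ∣
      i≤+∣i∣ (+ _)    = ≤-refl
      i≤+∣i∣ -[1+ _ ] = -≤+
    labels-suffice : + 4 * (↧ d * + b) ≤ + suc k
    labels-suffice = subst (_≤ + suc k) (trans (pos-* 4 (↧ₙ d ℕ.* b)) (cong (+ 4 *_) (pos-* (↧ₙ d) b)))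
      (+≤+ (ℕₚ.≤-trans (ℕₚ.n≤1+n _) (ℕₚ.n≤1+n k)))
    min-degree : MinDegreeAtLeast graph d
    min-degree v = ≤-scaled d (order graph) (degree graph v)
      (subst (λ z → ↥ d * z ≤ ↧ d * + degree graph v) (sym order-graph)
        (degree-arithmetic (↥ d) (↧ d) (+ b) (+ suc k) (F * + M) (+ w) (+ degree graph v)
          0≤pos (+≤+ (s≤s z≤n)) (0≤* {F} {+ M} 0≤pos 0≤pos) (i<j⇒suc[i]≤j (<-threshold b d d<t))
          (degree-large v) labels-suffice copies-suffice))
    uncolourable : ¬ Colourable graph C
    uncolourable col = ℕₚ.<-irrefl refl (graph-uncolourable C col)

  -- Reduction of general parameters to the two extreme families

  LocallyPartite-bipartite : ∀ a b G → LocallyPartite a (suc (suc b)) G → LocallyPartite (b ℕ.+ a) 2 G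
  LocallyPartite-bipartite a b G loc =
    LocallyPartite-+ b {a} {1} {G} (subst (λ z → LocallyPartite a z G) (ℕₚ.+-comm 2 b) loc)

  LocallyPartite-from-1 : ∀ a b G → LocallyPartite 1 (a ℕ.+ suc b) G → LocallyPartite (suc a) (suc b) G
  LocallyPartite-from-1 a b G loc =
    subst (λ z → LocallyPartite z (suc b) G) (ℕₚ.+-comm a 1) (LocallyPartite-+ a {1} {b} {G} loc)

  -- Both shapes of `ℓ` are needed: a successor for the two bounds, and a sum with `a` for trading
  -- colours against clique vertices. Here `a` and `b` are one and two less than in the theorem.
  threshold : ∀ a b ℓ → ℓ ≡ suc (b ℕ.+ suc a) → ℓ ≡ a ℕ.+ suc (suc b) →
              ChromaticThresholdIs (LocallyPartite (suc a) (suc (suc b))) (1ℚ ℚ.- inv ℓ)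
  threshold a b ℓ refl ℓ≡ = above , below
    where
    above : ∀ d → 1ℚ ℚ.- inv ℓ ℚ.< d →
            ∃ λ C → ∀ G → LocallyPartite (suc a) (suc (suc b)) G → MinDegreeAtLeast G d → Colourable G C
    above d t<d = proj₁ bounded , λ G loc → proj₂ bounded G (LocallyPartite-bipartite (suc a) b G loc)
      where
      bounded : ∃ λ C → ∀ G → LocallyPartite (b ℕ.+ suc a) 2 G → MinDegreeAtLeast G d → Colourable G C
      bounded = bounded-colouring (b ℕ.+ suc a) d t<d
    below : ∀ d → d ℚ.< 1ℚ ℚ.- inv ℓ → ∀ C →
            ∃ λ G → LocallyPartite (suc a) (suc (suc b)) G × MinDegreeAtLeast G d × ¬ Colourable G C
    below d d<t C = proj₁ unbounded ,
      LocallyPartite-from-1 a (suc b) (proj₁ unbounded)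
        (subst (λ z → LocallyPartite 1 z (proj₁ unbounded)) ℓ≡ (proj₁ (proj₂ unbounded))) ,
      proj₂ (proj₂ unbounded)
      where
      unbounded : ∃ λ G → LocallyPartite 1 ℓ G × MinDegreeAtLeast G d × ¬ Colourable G C
      unbounded = unbounded-below-threshold (b ℕ.+ suc a) d d<t C

  thresholds : ∀ a b → 1 ℕ.≤ a → 2 ℕ.≤ b →
    ChromaticThresholdIs (LocallyPartite a b) (1ℚ ℚ.- inv (a ℕ.+ b ℕ.∸ 1))
    × ChromaticThresholdIs (LocallyPartite 1 b) (1ℚ ℚ.- inv b)
  thresholds (suc a) (suc (suc b)) (s≤s _) (s≤s (s≤s _)) =
    threshold a b (a ℕ.+ suc (suc b)) (ℓ≡ a b) refl ,
    threshold 0 b (suc (suc b)) (ℓ≡ 0 b) refl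
    where
    ℓ≡ : ∀ a b → a ℕ.+ suc (suc b) ≡ suc (b ℕ.+ suc a)
    ℓ≡ = ℕ-solve-∀

open import Defs
open import Data.Nat using (ℕ; _+_; _∸_; _≤_)
open import Data.Rational using (_-_; 1ℚ)
open import Data.Product using (_×_)

theorem1p2 : (a b : ℕ) → 1 ≤ a → 2 ≤ b →
    ChromaticThresholdIs (LocallyPartite a b) (1ℚ - inv (a + b ∸ 1))
    × ChromaticThresholdIs (LocallyPartite 1 b) (1ℚ - inv b)
theorem1p2 = Development.thresholds
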